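{- Let $G=(V,E)$ be any finite bipartite graph, and for every vertex $u\in V$ fix an arbitrary strict total order (its preference order) over $V\setminus\{u\}$. Run the Random Decision Order (RDO) algorithm on $G$ with these preference orders. Then $\mathbb{E}[|M|]\ge 0.639\cdot|M^*|$, where $M$ is the (random) matching output by RDO and $M^*$ is a maximum matching of $G$.
   Context: Random Decision Order (RDO): every vertex $u$ independently draws a rank (decision time) $y_u$ uniformly from $[0,1]$. Vertices are processed in ascending order of their ranks, starting from the empty matching. When vertex $u$ is processed, if $u$ is still unmatched and has at least one unmatched neighbor in $G$, then $u$ is matched to the unmatched neighbor that comes first in $u$'s preference order; otherwise nothing happens. The preference orders are fixed in advance and do not depend on the ranks. (The algorithm is oblivious: it does not know $E$ in advance and learns whether a pair is an edge only by probing it; a probed existing edge whose endpoints are both unmatched is irrevocably added.) -}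

module Defs where

open import Data.Bool using (Bool; true; false; if_then_else_; _∧_)
open import Data.Nat using (ℕ; zero; suc; _+_; _*_; _≤_)
open import Data.Fin using (Fin; _≟_)
open import Data.Maybe using (Maybe; just; nothing; is-nothing)
open import Data.Product using (_×_; _,_; proj₁; proj₂; Σ)
open import Data.List using (List; []; _∷_; map; concatMap; foldl; length; allFin; concat)
open import Data.Nat.ListAction using (sum)
open import Data.List.Membership.Propositional using (_∈_; _∉_)
open import Data.List.Relation.Unary.All using (All)
open import Data.List.Relation.Unary.Unique.Propositional using (Unique)
open import Relation.Nullary using (¬_; does)
open import Relation.Binary.PropositionalEquality using (_≡_; _≢_)

record SimpleGraph (n : ℕ) : Set where
  field
    Adj      : Fin n → Fin n → Bool
    symmetric : ∀ u v → Adj u v ≡ Adj v u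
    irreflexive : ∀ u → Adj u u ≡ false

open SimpleGraph public

IsBipartite : ∀ {n} → SimpleGraph n → Set
IsBipartite {n} G = Σ (Fin n → Bool) λ c → ∀ u v → Adj G u v ≡ true → c u ≢ c v

-- A strict total order on V ∖ {u}, represented as the list of the vertices
-- of V ∖ {u} from most preferred to least preferred (each exactly once).
IsPrefOrder : ∀ {n} → Fin n → List (Fin n) → Set
IsPrefOrder {n} u l = Unique l × (u ∉ l) × (∀ v → v ≢ u → v ∈ l)

endpoints : ∀ {n} → List (Fin n × Fin n) → List (Fin n)
endpoints [] = []
endpoints ((u , v) ∷ es) = u ∷ v ∷ endpoints es

IsMatching : ∀ {n} → SimpleGraph n → List (Fin n × Fin n) → Set
IsMatching G M = All (λ e → Adj G (proj₁ e) (proj₂ e) ≡ true) M × Unique (endpoints M)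

IsMaximumMatching : ∀ {n} → SimpleGraph n → List (Fin n × Fin n) → Set
IsMaximumMatching {n} G M =
  IsMatching G M × (∀ (M' : List (Fin n × Fin n)) → IsMatching G M' → length M' ≤ length M)

insertAll : ∀ {A : Set} → A → List A → List (List A)
insertAll x [] = (x ∷ []) ∷ []
insertAll x (y ∷ ys) = (x ∷ y ∷ ys) ∷ map (y ∷_) (insertAll x ys)

perms : ∀ {A : Set} → List A → List (List A)
perms [] = [] ∷ []
perms (x ∷ xs) = concatMap (insertAll x) (perms xs)

module RDO {n : ℕ} (G : SimpleGraph n) (pref : Fin n → List (Fin n)) where

  -- mate u = just v  iff u is matched to v
  State : Set
  State = Fin n → Maybe (Fin n)

  choose : State → Fin n → List (Fin n) → Maybe (Fin n)
  choose s u [] = nothing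
  choose s u (v ∷ vs) = if Adj G u v ∧ is-nothing (s v) then just v else choose s u vs

  assign : State → Fin n → Fin n → State
  assign s u v w = if does (w ≟ u) then just v else (if does (w ≟ v) then just u else s w)

  step : State × ℕ → Fin n → State × ℕ
  step (s , k) u with s u
  ... | just _ = (s , k)
  ... | nothing with choose s u (pref u)
  ...   | nothing = (s , k)
  ...   | just v = (assign s u v , suc k)

  run : List (Fin n) → ℕ
  run order = proj₂ (foldl step ((λ _ → nothing) , 0) order)

  -- Σ over all n! equally likely processing orders of |M|
  totalSize : ℕ
  totalSize = sum (map run (perms (allFin n)))

  numOrders : ℕ
  numOrders = length (perms (allFin n))

-- An edge added at rank k pays f k to its active endpoint (the one deciding) and 1 − f k to the
-- passive one, so it is enough that the two endpoints u, v of every edge of the maximum matching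
-- together earn 0.639 on average, whatever the ranks of the other vertices.  Compare with the base
-- run, in which u and v never decide.  Since G is bipartite, once e ∈ {u , v} has been matched by
-- its own decision, the free vertices of the colour of e contain those of the base run other than
-- e, and the free vertices of the opposite colour are among those of the base run.  This bounds
-- what u and v earn from below in terms of their own ranks, the rank t at which the base run first
-- matches one of them, and whether they would choose each other.  With f constant on 80 blocks of
-- ranks, the bound grows with t inside a block, so that only the block boundaries matter.
-- Continuous ranks are replaced by dummy items mixed into the processing order: the rank of a
-- vertex is the number of dummies before it, and inserting dummies leaves the average unchanged.
module Submission where

open import Defs
open import Data.Bool as Bool using (Bool; true; false; if_then_else_; _∧_)
open import Data.Nat hiding (_≟_)
open import Data.Nat.Properties hiding (_≟_)
open import Data.Nat.DivMod
open import Data.Nat.Divisibility using (n∣m*n)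
open import Data.Nat.ListAction using (sum)
open import Data.Nat.ListAction.Properties using (sum-++)
open import Data.Nat.Tactic.RingSolver using (solve-∀)
open import Data.Fin using (Fin; _≟_)
open import Data.Maybe using (Maybe; just; nothing; is-nothing; maybe′)
import Data.Maybe.Properties
open import Data.Maybe.Properties using (just-injective)
open import Data.List using (List; []; _∷_; _++_; map; concatMap; foldl; length; catMaybes; replicate; allFin)
import Data.List
import Data.List.Properties as List
open import Data.List.Membership.Propositional using (_∈_)
open import Data.List.Membership.Propositional.Properties using (∈-allFin)
open import Data.List.Relation.Unary.Any using (here; there)
open import Data.List.Relation.Unary.All as All using (All; []; _∷_)
import Data.List.Relation.Unary.All.Properties as All
open import Data.List.Relation.Unary.AllPairs using ([]; _∷_)
open import Data.List.Relation.Unary.Linked as Linked using (Linked; []; _∷_)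
open import Data.List.Relation.Unary.Unique.Propositional using (Unique)
open import Data.List.Relation.Unary.Unique.Propositional.Properties using (allFin⁺)
open import Data.List.Relation.Binary.Permutation.Propositional as Perm using (_↭_; ↭-sym; ↭-trans; prep)
open import Data.List.Relation.Binary.Permutation.Propositional.Properties using (↭-length; All-resp-↭; shift; ++⁺ˡ) renaming (map⁺ to ↭-map⁺)
open import Data.Product hiding (swap; map)
open import Data.Empty using (⊥-elim)
open import Data.Unit using (tt)
open import Data.Sum using (_⊎_; inj₁; inj₂; [_,_]′)
open import Relation.Binary.PropositionalEquality
open import Relation.Nullary
open import Relation.Nullary.Decidable using (toWitness)
open import Relation.Unary using (Decidable)
open import Function using (_∘_)

-- What `u` and `v` would choose at each rank is unknown. Wherever it matters, every rank is charged
-- the cheaper of two scenarios, independently of the other ranks, which reduces the estimate to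
-- sums over single ranks. Two facts carry the comparison with the base run. Preference lists are
-- fixed, so a decider whose choices in two runs are each available in the other run chooses alike
-- in both. And an active share never exceeds a passive one, at whatever ranks, while passive shares
-- do not grow with the rank: an endpoint already matched when an argument wants it to act has
-- earned enough. If the base run matches neither endpoint there is no t; the parameter is then the
-- first rank θ at which one of them would choose the other. No limit is taken: all inequalities are
-- between natural numbers, and the two losses, equal ranks of `u` and `v` and positions behind
-- other vertices of the same rank, are of lower order in the number of dummies. The scores are
-- therefore checked against 0.6391, and the surplus pays for both.

-- Finite sums over ranks and over pairs of ranks

∑ : ℕ → (ℕ → ℕ) → ℕ
∑ zero f = 0
∑ (suc n) f = ∑ n f + f n

∑-mono : ∀ n {f g : ℕ → ℕ} → (∀ i → i < n → f i ≤ g i) → ∑ n f ≤ ∑ n g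
∑-mono zero h = z≤n
∑-mono (suc n) h = +-mono-≤ (∑-mono n λ i i<n → h i (m<n⇒m<1+n i<n)) (h n (n<1+n n))

∑-cong : ∀ n {f g : ℕ → ℕ} → (∀ i → i < n → f i ≡ g i) → ∑ n f ≡ ∑ n g
∑-cong zero h = refl
∑-cong (suc n) h = cong₂ _+_ (∑-cong n λ i i<n → h i (m<n⇒m<1+n i<n)) (h n (n<1+n n))

∑-+ : ∀ n (f g : ℕ → ℕ) → ∑ n (λ i → f i + g i) ≡ ∑ n f + ∑ n g
∑-+ zero f g = refl
∑-+ (suc n) f g rewrite ∑-+ n f g = interchange (∑ n f) (∑ n g) (f n) (g n)
  where interchange : ∀ a b c d → (a + b) + (c + d) ≡ (a + c) + (b + d)
        interchange = solve-∀

∑-* : ∀ n c (f : ℕ → ℕ) → ∑ n (λ i → c * f i) ≡ c * ∑ n f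
∑-* zero c f = sym (*-zeroʳ c)
∑-* (suc n) c f rewrite ∑-* n c f = sym (*-distribˡ-+ c (∑ n f) (f n))

∑-const : ∀ n c → ∑ n (λ _ → c) ≡ n * c
∑-const zero c = refl
∑-const (suc n) c rewrite ∑-const n c = +-comm (n * c) c

∑-split : ∀ m n (f : ℕ → ℕ) → ∑ (m + n) f ≡ ∑ m f + ∑ n (λ i → f (m + i))
∑-split m zero f rewrite +-identityʳ m = sym (+-identityʳ (∑ m f))
∑-split m (suc n) f rewrite +-suc m n | ∑-split m n f = +-assoc (∑ m f) _ _

∑-first : ∀ n (f : ℕ → ℕ) → ∑ (suc n) f ≡ f 0 + ∑ n (f ∘ suc)
∑-first n f = ∑-split 1 n f

∑-blocks : ∀ T B (f : ℕ → ℕ) → ∑ (T * B) f ≡ ∑ T (λ j → ∑ B (λ s → f (j * B + s)))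
∑-blocks zero B f = refl
∑-blocks (suc T) B f rewrite +-comm B (T * B) | ∑-split (T * B) B f | ∑-blocks T B f = refl

∑-triangle : ∀ n (g : ℕ → ℕ → ℕ) →
  ∑ n (λ j → ∑ j (λ i → g i j)) ≡ ∑ n (λ i → ∑ (n ∸ suc i) (λ d → g i (suc i + d)))
∑-triangle zero g = refl
∑-triangle (suc n) g rewrite ∑-triangle n g | n∸n≡0 n | +-identityʳ (∑ n (λ i → ∑ (n ∸ i) (λ d → g i (suc i + d)))) =
  trans (sym (∑-+ n _ _)) (∑-cong n row)
  where
  row : ∀ i → i < n → ∑ (n ∸ suc i) (λ d → g i (suc i + d)) + g i n ≡ ∑ (n ∸ i) (λ d → g i (suc i + d))
  row i i<n rewrite +-∸-assoc 1 i<n | m+[n∸m]≡n i<n = refl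

≤-witness : ∀ {m n} → m ≤ n → ∃[ k ] n ≡ m + k
≤-witness m≤n = _ , sym (m+[n∸m]≡n m≤n)

⊓-shift : ∀ a {b b′ x y} → b + x ≡ b′ + y → x ≤ y → (a ⊓ b) + x ≤ (a ⊓ b′) + y
⊓-shift a {b} {b′} {x} {y} eq x≤y rewrite +-distribʳ-⊓ y a b′ =
  ⊓-glb (+-mono-≤ (m⊓n≤m a b) x≤y) (≤-trans (+-monoˡ-≤ x (m⊓n≤n a b)) (≤-reflexive eq))

triangle : ℕ → (ℕ → ℕ → ℕ) → ℕ
triangle n g = ∑ n (λ j → ∑ j (λ i → g i j))

rowFrom : ℕ → (ℕ → ℕ → ℕ) → ℕ → ℕ
rowFrom n g i = ∑ (n ∸ suc i) (λ d → g i (suc i + d))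

rowFrom-≥ : ∀ n g i c → (∀ j → i < j → j < n → c ≤ g i j) → (n ∸ suc i) * c ≤ rowFrom n g i
rowFrom-≥ n g i c h = ≤-trans (≤-reflexive (sym (∑-const (n ∸ suc i) c)))
  (∑-mono (n ∸ suc i) λ d d< → h (suc i + d) (m≤m+n (suc i) d) (≤-trans (+-monoʳ-< (suc i) d<) (bound d<)))
  where
  bound : ∀ {d} → d < n ∸ suc i → suc i + (n ∸ suc i) ≤ n
  bound {d} d< with suc i ≤? n
  ... | yes p = ≤-reflexive (m+[n∸m]≡n p)
  ... | no ¬p = ⊥-elim (n≮0 (subst (d <_) (m≤n⇒m∸n≡0 (<⇒≤ (≰⇒> ¬p))) d<))

∑-≥const : ∀ n {g : ℕ → ℕ} c → (∀ i → i < n → c ≤ g i) → n * c ≤ ∑ n g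
∑-≥const n c h = ≤-trans (≤-reflexive (sym (∑-const n c))) (∑-mono n h)

-- Pairs are separated by their position relative to a threshold. Pairs lying above it are regrouped
-- by the smaller rank, since a passive gain is uniform in the later rank; straddling pairs stay
-- grouped by the larger one.
triangle-cut : ∀ {N} θ M g → N ≡ θ + M → triangle N g ≡
  triangle θ g + ∑ M (λ d → ∑ θ (λ h → g h (θ + d))) + ∑ M (λ d → rowFrom N g (θ + d))
triangle-cut θ M g refl = begin
    triangle (θ + M) g
  ≡⟨ ∑-split θ M _ ⟩
    triangle θ g + ∑ M (λ d → ∑ (θ + d) (λ i → g i (θ + d)))
  ≡⟨ cong (triangle θ g +_) (trans (∑-cong M λ d _ → ∑-split θ d _) (∑-+ M _ _)) ⟩
    triangle θ g + (∑ M (λ d → ∑ θ (λ h → g h (θ + d))) + triangle M (λ i j → g (θ + i) (θ + j)))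
  ≡⟨ sym (+-assoc (triangle θ g) _ _) ⟩
    triangle θ g + ∑ M (λ d → ∑ θ (λ h → g h (θ + d))) + triangle M (λ i j → g (θ + i) (θ + j))
  ≡⟨ cong (triangle θ g + ∑ M (λ d → ∑ θ (λ h → g h (θ + d))) +_)
       (trans (∑-triangle M _) (∑-cong M λ d _ → row d)) ⟩
    _ ∎
  where
  open ≡-Reasoning
  row : ∀ d → ∑ (M ∸ suc d) (λ e → g (θ + d) (θ + (suc d + e))) ≡ rowFrom (θ + M) g (θ + d)
  row d rewrite sym (+-suc θ d) | [m+n]∸[m+o]≡n∸o θ M (suc d) =
    ∑-cong (M ∸ suc d) λ e _ → cong (g (θ + d)) (trans (+-suc θ (d + e)) (cong suc (sym (+-assoc θ d e))))

2∑-descending : ∀ e → 2 * ∑ e (λ d → e ∸ suc d) + e ≡ e * e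
2∑-descending zero = refl
2∑-descending (suc e) rewrite ∑-first e (λ d → e ∸ d) =
  trans (rearrange e (∑ e (λ d → e ∸ suc d))) (trans (cong (_+ (2 * e + 1)) (2∑-descending e)) (square e))
  where
  rearrange : ∀ e s → 2 * (e + s) + suc e ≡ 2 * s + e + (2 * e + 1)
  rearrange = solve-∀
  square : ∀ e → e * e + (2 * e + 1) ≡ suc e * suc e
  square = solve-∀

-- Lower bounds on the earnings of one edge as sums over ranks

-- Raising t by one costs at most `π - φ` in each of the t earlier rows and `(2M + 1)π` in the
-- corner square, and it adds the row `2φ(M + 1) + Z`. Whichever arm gives `Z`, the balance is the
-- slack `k` of the first hypothesis plus a nonnegative surplus; `extra` is their sum.
H-step-arith : ∀ t M φ π X Y Z → (t + suc M) * π ≤ (t + suc M + suc M) * φ →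
  X + t * φ ≤ Y + t * π → Z ≡ π * suc M ⊎ Z ≡ suc t * φ + φ + M * π →
  X + suc M * suc M * π ≤ Y + (2 * φ * suc M + Z) + M * M * π
H-step-arith t M φ π X Y Z cond h cases with ≤-witness cond
... | k , eq = +-cancelʳ-≤ (t * φ) _ _ (begin
    X + suc M * suc M * π + t * φ
  ≡⟨ shuffle₁ X (suc M * suc M * π) (t * φ) ⟩
    (X + t * φ) + suc M * suc M * π
  ≤⟨ +-monoˡ-≤ _ h ⟩
    Y + t * π + suc M * suc M * π
  ≤⟨ m≤m+n _ (extra cases) ⟩
    Y + t * π + suc M * suc M * π + extra cases
  ≡⟨ gain cases ⟩
    Y + (2 * φ * suc M + Z) + M * M * π + t * φ ∎)
  where
  open ≤-Reasoning
  shuffle₁ : ∀ a b c → a + b + c ≡ (a + c) + b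
  shuffle₁ = solve-∀
  extra : Z ≡ π * suc M ⊎ Z ≡ suc t * φ + φ + M * π → ℕ
  extra (inj₁ _) = π + k
  extra (inj₂ _) = k + (2 + t) * φ
  lhs₁ : ∀ Y t M π k → Y + t * π + suc M * suc M * π + (π + k)
                     ≡ ((t + suc M) * π + k) + (Y + π * suc M + M * M * π)
  lhs₁ = solve-∀
  rhs₁ : ∀ Y t M φ Z R → (t + suc M + suc M) * φ + (Y + Z + R)
                     ≡ Y + (2 * φ * suc M + Z) + R + t * φ
  rhs₁ = solve-∀
  lhs₂ : ∀ Y t M φ π k → Y + t * π + suc M * suc M * π + (k + (2 + t) * φ)
                     ≡ ((t + suc M) * π + k) + (Y + (suc t * φ + φ + M * π) + M * M * π)
  lhs₂ = solve-∀
  gain : (c : Z ≡ π * suc M ⊎ Z ≡ suc t * φ + φ + M * π) →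
    Y + t * π + suc M * suc M * π + extra c ≡ Y + (2 * φ * suc M + Z) + M * M * π + t * φ
  gain (inj₁ refl) = trans (lhs₁ Y t M π k) (trans (cong (_+ (Y + Z + M * M * π)) (sym eq)) (rhs₁ Y t M φ Z (M * M * π)))
  gain (inj₂ refl) = trans (lhs₂ Y t M φ π k) (trans (cong (_+ (Y + Z + M * M * π)) (sym eq)) (rhs₁ Y t M φ Z (M * M * π)))

-- f k is the share of the active endpoint of an edge added at rank k, p k that of the passive one.
module Shares (S : ℕ) (f p : ℕ → ℕ) (f≤p : ∀ k → f k ≤ p k) (f+p≡S : ∀ k → f k + p k ≡ S) (N : ℕ) where

  p≤S : ∀ k → p k ≤ S
  p≤S k = ≤-trans (m≤n+m (p k) (f k)) (≤-reflexive (f+p≡S k))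

  2f≤S : ∀ k → f k + f k ≤ S
  2f≤S k = ≤-trans (+-monoʳ-≤ (f k) (f≤p k)) (≤-reflexive (f+p≡S k))

  -- If v at rank y would choose u, then u earns arm₁ y over all later ranks of its own; if not,
  -- u and v together earn arm₂ t π y, where the base run matches u just before rank t and π is
  -- the passive share for it.
  arm₁ : ℕ → ℕ
  arm₁ y = p y * (N ∸ y)

  arm₂ : ℕ → ℕ → ℕ → ℕ
  arm₂ t π y = suc y * f y + ∑ (t ∸ y) (λ d → f (y + d)) + (N ∸ t) * π

  -- The rows when the base run matches neither u nor v and θ is the first rank at which v, say,
  -- would choose u: from then on v always would.
  lowerRow : ℕ → ℕ
  lowerRow y = 2 * f y * (N ∸ y) + 2 * suc y * f y

  upperRow : ℕ → ℕ → ℕ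
  upperRow θ y = 2 * f y * (N ∸ y) + (arm₁ y + (arm₁ y ⊓ (θ * f y)))

  -- The term `2 * f y * (N ∸ y)` pays whichever of u and v decides first, at y. The minimum arises
  -- because whom v would choose may change from rank to rank. The square at the end stands for the
  -- pairs of ranks from t on: there the base run has matched u before either endpoint decides.
  H : ℕ → ℕ → ℕ
  H t π = ∑ t (λ y → 2 * f y * (N ∸ y) + (arm₁ y ⊓ arm₂ t π y)) + (N ∸ t) * (N ∸ t) * π

  H-step : ∀ t → t < N → N * p t ≤ (N + (N ∸ t)) * f t → H t (p t) ≤ H (suc t) (p t)
  H-step t t<N cond = subst₂ _≤_
    (cong (λ m → ∑ t old + m * m * p t) (sym N∸t))
    refl
    (subst (λ m → ∑ t old + suc M * suc M * p t ≤ ∑ t new + (2 * f t * m + Z) + M * M * p t) (sym N∸t)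
      (H-step-arith t M (f t) (p t) (∑ t old) (∑ t new) Z cond′ sums arms))
    where
    M = N ∸ suc t
    N∸t : N ∸ t ≡ suc M
    N∸t = +-∸-assoc 1 t<N
    old new : ℕ → ℕ
    old y = 2 * f y * (N ∸ y) + (arm₁ y ⊓ arm₂ t (p t) y)
    new y = 2 * f y * (N ∸ y) + (arm₁ y ⊓ arm₂ (suc t) (p t) y)
    Z = arm₁ t ⊓ arm₂ (suc t) (p t) t
    N≡ : N ≡ t + suc M
    N≡ = trans (sym (m+[n∸m]≡n (<⇒≤ t<N))) (cong (t +_) N∸t)
    cond′ : (t + suc M) * p t ≤ (t + suc M + suc M) * f t
    cond′ = subst₂ (λ a b → a * p t ≤ (a + b) * f t) N≡ N∸t cond
    arm-shift : ∀ y → y < t → arm₂ t (p t) y + f t ≡ arm₂ (suc t) (p t) y + p t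
    arm-shift y y<t = begin
        suc y * f y + ∑ (t ∸ y) g + (N ∸ t) * p t + f t
      ≡⟨ cong (λ m → suc y * f y + ∑ (t ∸ y) g + m * p t + f t) N∸t ⟩
        suc y * f y + ∑ (t ∸ y) g + suc M * p t + f t
      ≡⟨ shuffle (suc y * f y) (∑ (t ∸ y) g) M (p t) (f t) ⟩
        suc y * f y + (∑ (t ∸ y) g + f t) + M * p t + p t
      ≡⟨ cong (λ z → suc y * f y + z + M * p t + p t) last ⟩
        suc y * f y + ∑ (suc t ∸ y) g + M * p t + p t ∎
      where
      open ≡-Reasoning
      g : ℕ → ℕ
      g d = f (y + d)
      shuffle : ∀ a s m π φ → a + s + suc m * π + φ ≡ a + (s + φ) + m * π + π
      shuffle = solve-∀
      last : ∑ (t ∸ y) g + f t ≡ ∑ (suc t ∸ y) g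
      last rewrite +-∸-assoc 1 (<⇒≤ y<t) | m+[n∸m]≡n (<⇒≤ y<t) = refl
    sums : ∑ t old + t * f t ≤ ∑ t new + t * p t
    sums = subst₂ _≤_
      (trans (∑-+ t old (λ _ → f t)) (cong (∑ t old +_) (∑-const t (f t))))
      (trans (∑-+ t new (λ _ → p t)) (cong (∑ t new +_) (∑-const t (p t))))
      (∑-mono t λ y y<t → subst₂ _≤_ (sym (+-assoc (2 * f y * (N ∸ y)) _ (f t))) (sym (+-assoc (2 * f y * (N ∸ y)) _ (p t)))
        (+-monoʳ-≤ (2 * f y * (N ∸ y)) (⊓-shift (arm₁ y) (arm-shift y y<t) (f≤p t))))
    arms : Z ≡ p t * suc M ⊎ Z ≡ suc t * f t + f t + M * p t
    arms with ⊓-sel (arm₁ t) (arm₂ (suc t) (p t) t)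
    ... | inj₁ e = inj₁ (trans e (cong (p t *_) N∸t))
    ... | inj₂ e = inj₂ (trans e (cong (λ z → suc t * f t + z + M * p t) one))
      where
      one : ∑ (suc t ∸ t) (λ d → f (t + d)) ≡ f t
      one rewrite m+n∸n≡m 1 t | +-identityʳ t = refl

  -- For ranks i < j, au i j and bv i j are the gains of u and v when u decides at i and v at j;
  -- bu i j and av i j are those of v and u when v decides at i and u at j.
  module Gains (au bv bu av : ℕ → ℕ → ℕ) where

    total : ℕ
    total = triangle N au + triangle N bv + triangle N bu + triangle N av

    -- `bv` is gathered by the later rank, the other three by the earlier one. In this way `bv h i`
    -- and `av i j`, the two gains governed by whom v would choose at rank i, meet in one row and
    -- share one case distinction.
    row : ℕ → ℕ
    row i = rowFrom N au i + ∑ i (λ h → bv h i) + rowFrom N bu i + rowFrom N av i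

    total-rows : total ≡ ∑ N row
    total-rows = begin
        total
      ≡⟨ cong₂ _+_ (cong₂ _+_ (cong (_+ triangle N bv) (∑-triangle N au)) (∑-triangle N bu)) (∑-triangle N av) ⟩
        ∑ N (rowFrom N au) + triangle N bv + ∑ N (rowFrom N bu) + ∑ N (rowFrom N av)
      ≡⟨ cong (λ z → z + ∑ N (rowFrom N bu) + ∑ N (rowFrom N av)) (sym (∑-+ N _ _)) ⟩
        _
      ≡⟨ cong (_+ ∑ N (rowFrom N av)) (sym (∑-+ N _ _)) ⟩
        _
      ≡⟨ sym (∑-+ N _ _) ⟩
        ∑ N row ∎
      where open ≡-Reasoning

    -- The rows of `H` count `N ∸ i` partners for rank i, but only `N ∸ suc i` ranks are strictly
    -- later. The term `N * (2 * S)` covers these diagonal pairs, at most `2 * S` per rank. The base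
    -- run hits at rank t, so its prefix of unhit ranks has length `suc t`.
    hit-bound : ∀ t → t < N →
      (∀ i j → i < j → j < N → i ≤ t → f i ≤ au i j × f i ≤ bu i j) →
      (∀ i j → i < j → j < N → t < i → p t ≤ au i j × p t ≤ av i j) →
      (∀ i → i ≤ t →
        (∀ j → i < j → j < N → p i ≤ av i j) ⊎
        ((∀ h → h < i → f i ≤ bv h i) ×
         (∀ j → i < j → j ≤ t → f j ≤ av i j) ×
         (∀ j → t < j → j < N → p t ≤ av i j))) →
      H (suc t) (p t) ≤ total + N * (2 * S)
    hit-bound t t<N first late second = begin
        H (suc t) (p t)
      ≤⟨ +-mono-≤ (∑-mono (suc t) early-row) late-rows ⟩
        ∑ (suc t) (λ i → row i + 2 * S) + (∑ e (λ d → row (suc t + d)) + e * (2 * S))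
      ≡⟨ cong (_+ (∑ e (λ d → row (suc t + d)) + e * (2 * S)))
           (trans (∑-+ (suc t) row _) (cong (∑ (suc t) row +_) (∑-const (suc t) (2 * S)))) ⟩
        ∑ (suc t) row + suc t * (2 * S) + (∑ e (λ d → row (suc t + d)) + e * (2 * S))
      ≡⟨ shuffle (∑ (suc t) row) (suc t) (∑ e (λ d → row (suc t + d))) e (2 * S) ⟩
        (∑ (suc t) row + ∑ e (λ d → row (suc t + d))) + (suc t + e) * (2 * S)
      ≡⟨ cong (_+ (suc t + e) * (2 * S)) (sym (∑-split (suc t) e row)) ⟩
        ∑ (suc t + e) row + (suc t + e) * (2 * S)
      ≡⟨ cong (λ m → ∑ m row + m * (2 * S)) (m+[n∸m]≡n t<N) ⟩
        ∑ N row + N * (2 * S)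
      ≡⟨ cong (_+ N * (2 * S)) (sym total-rows) ⟩
        total + N * (2 * S) ∎
      where
      open ≤-Reasoning
      e = N ∸ suc t
      shuffle : ∀ a t b e s → a + t * s + (b + e * s) ≡ (a + b) + (t + e) * s
      shuffle = solve-∀
      early-row : ∀ i → i < suc t → 2 * f i * (N ∸ i) + (arm₁ i ⊓ arm₂ (suc t) (p t) i) ≤ row i + 2 * S
      early-row i i<1+t = [ passive , (λ { (gb , ga , gl) → active gb ga gl }) ]′ (second i i≤t)
        where
        i≤t = ≤-pred i<1+t
        c = N ∸ suc i
        b = t ∸ i
        N∸i : N ∸ i ≡ suc c
        N∸i = +-∸-assoc 1 (≤-<-trans i≤t t<N)
        c≡b+e : c ≡ b + e
        c≡b+e = trans (cong (_∸ suc i) (trans (sym (m+[n∸m]≡n t<N)) (cong (λ m → suc m + e) (sym (m+[n∸m]≡n i≤t)))))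
          (trans (cong (_∸ i) (+-assoc i b e)) (m+n∸m≡n i (b + e)))
        au-row : c * f i ≤ rowFrom N au i
        au-row = rowFrom-≥ N au i (f i) λ j i<j j<N → proj₁ (first i j i<j j<N i≤t)
        bu-row : c * f i ≤ rowFrom N bu i
        bu-row = rowFrom-≥ N bu i (f i) λ j i<j j<N → proj₂ (first i j i<j j<N i≤t)
        passive : (∀ j → i < j → j < N → p i ≤ av i j) →
          2 * f i * (N ∸ i) + (arm₁ i ⊓ arm₂ (suc t) (p t) i) ≤ row i + 2 * S
        passive ga = begin
            2 * f i * (N ∸ i) + (arm₁ i ⊓ arm₂ (suc t) (p t) i)
          ≤⟨ +-monoʳ-≤ (2 * f i * (N ∸ i)) (m⊓n≤m (arm₁ i) _) ⟩
            2 * f i * (N ∸ i) + p i * (N ∸ i)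
          ≡⟨ cong (λ m → 2 * f i * m + p i * m) N∸i ⟩
            2 * f i * suc c + p i * suc c
          ≡⟨ expand (f i) (p i) c ⟩
            (c * f i + 0 + c * f i + c * p i) + ((f i + f i) + (p i + 0))
          ≤⟨ +-mono-≤ (+-mono-≤ (+-mono-≤ (+-mono-≤ au-row z≤n) bu-row) (rowFrom-≥ N av i (p i) ga))
               (+-mono-≤ (2f≤S i) (+-monoˡ-≤ 0 (p≤S i))) ⟩
            row i + 2 * S ∎
          where
          expand : ∀ φ π c → 2 * φ * suc c + π * suc c ≡ (c * φ + 0 + c * φ + c * π) + ((φ + φ) + (π + 0))
          expand = solve-∀
        active : (∀ h → h < i → f i ≤ bv h i) → (∀ j → i < j → j ≤ t → f j ≤ av i j) →
          (∀ j → t < j → j < N → p t ≤ av i j) →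
          2 * f i * (N ∸ i) + (arm₁ i ⊓ arm₂ (suc t) (p t) i) ≤ row i + 2 * S
        active gb ga gl = begin
            2 * f i * (N ∸ i) + (arm₁ i ⊓ arm₂ (suc t) (p t) i)
          ≤⟨ +-monoʳ-≤ (2 * f i * (N ∸ i)) (m⊓n≤n (arm₁ i) _) ⟩
            2 * f i * (N ∸ i) + (suc i * f i + ∑ (suc t ∸ i) (λ d → f (i + d)) + e * p t)
          ≡⟨ cong₂ (λ m s → 2 * f i * m + (suc i * f i + s + e * p t)) N∸i partial ⟩
            2 * f i * suc c + (suc i * f i + (f i + s) + e * p t)
          ≡⟨ expand (f i) c i s (e * p t) ⟩
            (c * f i + i * f i + c * f i + (s + e * p t)) + ((f i + f i) + (f i + f i + 0))
          ≤⟨ +-mono-≤ (+-mono-≤ (+-mono-≤ (+-mono-≤ au-row (∑-≥const i (f i) gb)) bu-row) av-row)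
               (+-mono-≤ (2f≤S i) (+-monoˡ-≤ 0 (2f≤S i))) ⟩
            row i + 2 * S ∎
          where
          s = ∑ b (λ d → f (suc i + d))
          expand : ∀ φ c i s r → 2 * φ * suc c + (suc i * φ + (φ + s) + r)
            ≡ (c * φ + i * φ + c * φ + (s + r)) + ((φ + φ) + (φ + φ + 0))
          expand = solve-∀
          partial : ∑ (suc t ∸ i) (λ d → f (i + d)) ≡ f i + s
          partial = trans (cong (λ m → ∑ m (λ d → f (i + d))) (+-∸-assoc 1 i≤t))
            (trans (∑-first b _) (cong₂ _+_ (cong f (+-identityʳ i)) (∑-cong b λ d _ → cong f (+-suc i d))))
          av-row : s + e * p t ≤ rowFrom N av i
          av-row = subst (s + e * p t ≤_)
            (sym (trans (cong (λ m → ∑ m (λ d → av i (suc i + d))) c≡b+e) (∑-split b e _)))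
            (+-mono-≤
              (∑-mono b λ d d<b → ga (suc i + d) (m≤m+n (suc i) d)
                (≤-trans (+-monoʳ-< i d<b) (≤-reflexive (m+[n∸m]≡n i≤t))))
              (∑-≥const e (p t) λ d d<e → subst (λ m → p t ≤ av i (suc m)) (+-assoc i b d)
                (subst (λ m → p t ≤ av i (suc (m + d))) (sym (m+[n∸m]≡n i≤t))
                  (gl (suc t + d) (m≤m+n (suc t) d)
                    (≤-trans (+-monoʳ-< (suc t) d<e) (≤-reflexive (m+[n∸m]≡n t<N)))))))
      -- The square beyond t consists of two triangles, covered by `au` and `av`, and a diagonal
      -- that goes into the error term.
      late-rows : e * e * p t ≤ ∑ e (λ d → row (suc t + d)) + e * (2 * S)
      late-rows = begin
          e * e * p t
        ≡⟨ cong (_* p t) (sym (2∑-descending e)) ⟩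
          (2 * ∑ e (λ d → e ∸ suc d) + e) * p t
        ≡⟨ expand (∑ e (λ d → e ∸ suc d)) e (p t) ⟩
          2 * p t * ∑ e (λ d → e ∸ suc d) + e * p t
        ≡⟨ cong (_+ e * p t) (sym (∑-* e (2 * p t) _)) ⟩
          ∑ e (λ d → 2 * p t * (e ∸ suc d)) + e * p t
        ≤⟨ +-mono-≤ (∑-mono e late-row) (*-monoʳ-≤ e (≤-trans (p≤S t) (m≤m+n S (S + 0)))) ⟩
          ∑ e (λ d → row (suc t + d)) + e * (2 * S) ∎
        where
        expand : ∀ s e π → (2 * s + e) * π ≡ 2 * π * s + e * π
        expand = solve-∀
        regroup : ∀ π m → 2 * π * m ≡ m * π + 0 + 0 + m * π
        regroup = solve-∀
        late-row : ∀ d → d < e → 2 * p t * (e ∸ suc d) ≤ row (suc t + d)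
        late-row d d<e = begin
            2 * p t * (e ∸ suc d)
          ≡⟨ cong (2 * p t *_) (trans (∸-+-assoc N (suc t) (suc d)) (cong (N ∸_) (+-suc (suc t) d))) ⟩
            2 * p t * (N ∸ suc (suc t + d))
          ≡⟨ regroup (p t) _ ⟩
            _
          ≤⟨ +-mono-≤ (+-mono-≤ (+-mono-≤
               (rowFrom-≥ N au (suc t + d) (p t) λ j i<j j<N → proj₁ (late _ j i<j j<N (m≤m+n (suc t) d))) z≤n) z≤n)
               (rowFrom-≥ N av (suc t + d) (p t) λ j i<j j<N → proj₂ (late _ j i<j j<N (m≤m+n (suc t) d))) ⟩
            row (suc t + d) ∎

    -- Below θ neither endpoint would choose the other, so the second decider also earns f. From θ
    -- on, u earns p at every later rank of its own. If u would choose v as well, v likewise earns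
    -- p. Otherwise u earns f when deciding second; this is counted only against ranks of v below θ,
    -- because against the others u is already credited with a passive share.
    no-hit-bound : ∀ θ M → N ≡ θ + M →
      (∀ i j → i < j → j < N → f i ≤ au i j × f i ≤ bu i j) →
      (∀ i h → i < θ → h < i → f i ≤ av h i × f i ≤ bv h i) →
      (∀ i j → θ ≤ i → i < j → j < N → p i ≤ av i j) →
      (∀ i → θ ≤ i → i < N → (∀ j → i < j → j < N → p i ≤ bv i j) ⊎ (∀ h → h < i → f i ≤ av h i)) →
      ∑ θ lowerRow + ∑ M (λ d → upperRow θ (θ + d)) ≤ total + N * (2 * S)
    no-hit-bound θ M N≡ first lower passive upper = begin
        ∑ θ lowerRow + ∑ M (λ d → upperRow θ (θ + d))
      ≤⟨ +-mono-≤ (∑-mono θ low-row) (∑-mono M up-row) ⟩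
        ∑ θ (λ i → low i + 2 * S) + ∑ M (λ d → up (θ + d) + 2 * S)
      ≡⟨ cong₂ _+_ (trans (∑-+ θ low _) (cong (∑ θ low +_) (∑-const θ (2 * S))))
                   (trans (∑-+ M _ _) (cong (∑ M (λ d → up (θ + d)) +_) (∑-const M (2 * S)))) ⟩
        ∑ θ low + θ * (2 * S) + (∑ M (λ d → up (θ + d)) + M * (2 * S))
      ≡⟨ shuffle (∑ θ low) θ (∑ M (λ d → up (θ + d))) M (2 * S) ⟩
        ∑ θ low + ∑ M (λ d → up (θ + d)) + (θ + M) * (2 * S)
      ≤⟨ +-mono-≤ cut (≤-reflexive (cong (_* (2 * S)) (sym N≡))) ⟩
        total + N * (2 * S) ∎
      where
      open ≤-Reasoning
      shuffle : ∀ a t b e s → a + t * s + (b + e * s) ≡ (a + b) + (t + e) * s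
      shuffle = solve-∀
      low up : ℕ → ℕ
      low i = rowFrom N au i + ∑ i (λ h → bv h i) + rowFrom N bu i + ∑ i (λ h → av h i)
      up i = rowFrom N au i + rowFrom N bv i + rowFrom N bu i + (∑ θ (λ h → av h i) + rowFrom N av i)
      θ+d<N : ∀ {d} → d < M → θ + d < N
      θ+d<N d<M = ≤-trans (+-monoʳ-< θ d<M) (≤-reflexive (sym N≡))
      -- No pair may be used twice. Above θ, `bv` is taken by its earlier rank, and `av` is taken by
      -- its later rank only if the earlier one lies below θ. The straddling part `R` of `bv` is
      -- given up.
      cut : ∑ θ low + ∑ M (λ d → up (θ + d)) ≤ total
      cut = begin
          ∑ θ low + ∑ M (λ d → up (θ + d))
        ≡⟨ cong₂ _+_
             (trans (∑-+ θ _ _) (cong (_+ triangle θ av) (trans (∑-+ θ _ _)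
               (cong (_+ ∑ θ (rowFrom N bu)) (∑-+ θ _ _)))))
             (trans (∑-+ M _ _) (cong₂ _+_ (trans (∑-+ M _ _)
               (cong (_+ ∑ M (λ d → rowFrom N bu (θ + d))) (∑-+ M _ _))) (∑-+ M _ _))) ⟩
          (A₁ + triangle θ bv + C₁ + triangle θ av) + ((A₂ + B₂ + C₂) + (D₁ + D₂))
        ≤⟨ m≤m+n _ R ⟩
          (A₁ + triangle θ bv + C₁ + triangle θ av) + ((A₂ + B₂ + C₂) + (D₁ + D₂)) + R
        ≡⟨ gather A₁ A₂ (triangle θ bv) R B₂ C₁ C₂ (triangle θ av) D₁ D₂ ⟩
          (A₁ + A₂) + (triangle θ bv + R + B₂) + (C₁ + C₂) + (triangle θ av + D₁ + D₂)
        ≡⟨ sym (cong₂ _+_ (cong₂ _+_ (cong₂ _+_ (rows au) (triangle-cut θ M bv N≡)) (rows bu)) (triangle-cut θ M av N≡)) ⟩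
          total ∎
        where
        A₁ = ∑ θ (rowFrom N au)
        A₂ = ∑ M (λ d → rowFrom N au (θ + d))
        B₂ = ∑ M (λ d → rowFrom N bv (θ + d))
        C₁ = ∑ θ (rowFrom N bu)
        C₂ = ∑ M (λ d → rowFrom N bu (θ + d))
        D₁ = ∑ M (λ d → ∑ θ (λ h → av h (θ + d)))
        D₂ = ∑ M (λ d → rowFrom N av (θ + d))
        R = ∑ M (λ d → ∑ θ (λ h → bv h (θ + d)))
        gather : ∀ a₁ a₂ b₁ r b₂ c₁ c₂ t d₁ d₂ →
          (a₁ + b₁ + c₁ + t) + ((a₂ + b₂ + c₂) + (d₁ + d₂)) + r
          ≡ (a₁ + a₂) + (b₁ + r + b₂) + (c₁ + c₂) + (t + d₁ + d₂)
        gather = solve-∀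
        rows : ∀ g → triangle N g ≡ ∑ θ (rowFrom N g) + ∑ M (λ d → rowFrom N g (θ + d))
        rows g = trans (∑-triangle N g) (trans (cong (λ n → ∑ n (rowFrom N g)) N≡) (∑-split θ M (rowFrom N g)))
      au-row : ∀ i → (N ∸ suc i) * f i ≤ rowFrom N au i
      au-row i = rowFrom-≥ N au i (f i) λ j i<j j<N → proj₁ (first i j i<j j<N)
      bu-row : ∀ i → (N ∸ suc i) * f i ≤ rowFrom N bu i
      bu-row i = rowFrom-≥ N bu i (f i) λ j i<j j<N → proj₂ (first i j i<j j<N)
      low-row : ∀ i → i < θ → lowerRow i ≤ low i + 2 * S
      low-row i i<θ = begin
          2 * f i * (N ∸ i) + 2 * suc i * f i
        ≡⟨ cong (λ m → 2 * f i * m + 2 * suc i * f i) (+-∸-assoc 1 (≤-trans i<θ (≤-trans (m≤m+n θ M) (≤-reflexive (sym N≡))))) ⟩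
          2 * f i * suc (N ∸ suc i) + 2 * suc i * f i
        ≡⟨ expand (f i) (N ∸ suc i) i ⟩
          (N ∸ suc i) * f i + i * f i + (N ∸ suc i) * f i + i * f i + ((f i + f i) + (f i + f i + 0))
        ≤⟨ +-mono-≤ (+-mono-≤ (+-mono-≤ (+-mono-≤ (au-row i)
             (∑-≥const i (f i) λ h h<i → proj₂ (lower i h i<θ h<i))) (bu-row i))
             (∑-≥const i (f i) λ h h<i → proj₁ (lower i h i<θ h<i)))
             (+-mono-≤ (2f≤S i) (+-monoˡ-≤ 0 (2f≤S i))) ⟩
          low i + 2 * S ∎
        where
        expand : ∀ φ c i → 2 * φ * suc c + 2 * suc i * φ ≡ c * φ + i * φ + c * φ + i * φ + ((φ + φ) + (φ + φ + 0))
        expand = solve-∀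
      up-row : ∀ d → d < M → upperRow θ (θ + d) ≤ up (θ + d) + 2 * S
      up-row d d<M = begin
          2 * f i * (N ∸ i) + (p i * (N ∸ i) + (p i * (N ∸ i) ⊓ (θ * f i)))
        ≤⟨ +-monoʳ-≤ (2 * f i * (N ∸ i)) (+-monoʳ-≤ (p i * (N ∸ i)) (choice (upper i (m≤m+n θ d) (θ+d<N d<M)))) ⟩
          2 * f i * (N ∸ i) + (p i * (N ∸ i) + (p i + (rowFrom N bv i + ∑ θ (λ h → av h i))))
        ≡⟨ cong (λ m → 2 * f i * m + (p i * m + (p i + (rowFrom N bv i + ∑ θ (λ h → av h i))))) N∸i ⟩
          2 * f i * suc c + (p i * suc c + (p i + (rowFrom N bv i + ∑ θ (λ h → av h i))))
        ≡⟨ expand (f i) (p i) c (rowFrom N bv i) (∑ θ (λ h → av h i)) ⟩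
          c * f i + rowFrom N bv i + c * f i + (∑ θ (λ h → av h i) + c * p i) + ((f i + p i) + (f i + p i + 0))
        ≤⟨ +-mono-≤ (+-mono-≤ (+-mono-≤ (+-monoˡ-≤ (rowFrom N bv i) (au-row i)) (bu-row i))
             (+-monoʳ-≤ (∑ θ (λ h → av h i)) (rowFrom-≥ N av i (p i) λ j i<j j<N → passive i j (m≤m+n θ d) i<j j<N)))
             (≤-reflexive (cong₂ (λ a b → a + (b + 0)) (f+p≡S i) (f+p≡S i))) ⟩
          up i + 2 * S ∎
        where
        i = θ + d
        c = N ∸ suc i
        N∸i : N ∸ i ≡ suc c
        N∸i = +-∸-assoc 1 (θ+d<N d<M)
        expand : ∀ φ π c b a → 2 * φ * suc c + (π * suc c + (π + (b + a)))
          ≡ c * φ + b + c * φ + (a + c * π) + ((φ + π) + (φ + π + 0))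
        expand = solve-∀
        choice : (∀ j → i < j → j < N → p i ≤ bv i j) ⊎ (∀ h → h < i → f i ≤ av h i) →
          p i * (N ∸ i) ⊓ (θ * f i) ≤ p i + (rowFrom N bv i + ∑ θ (λ h → av h i))
        choice (inj₁ b) = ≤-trans (m⊓n≤m _ (θ * f i)) (begin
            p i * (N ∸ i)
          ≡⟨ trans (cong (p i *_) N∸i) (*-comm (p i) (suc c)) ⟩
            p i + c * p i
          ≤⟨ +-monoʳ-≤ (p i) (≤-trans (rowFrom-≥ N bv i (p i) b) (m≤m+n _ _)) ⟩
            _ ∎)
        choice (inj₂ a) = ≤-trans (m⊓n≤n (p i * (N ∸ i)) _)
          (≤-trans (∑-≥const θ (f i) λ h h<θ → a h (≤-trans h<θ (m≤m+n θ d)))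
            (≤-trans (m≤n+m _ (rowFrom N bv i)) (m≤n+m _ (p i))))

-- Shares constant on blocks: reduction to finitely many scores

-- A lower bound, in units of B² / 2, for the sum over one block of
-- `(π * (k * B + (B ∸ s))) ⊓ (B * a)`. If `a` is at most `k * π`, the second argument is the
-- minimum throughout. Otherwise the first argument x is at most `B * (suc k * π)`, so capping it at
-- `B * a` loses at most `B * (suc k * π ∸ a)`.
cc : ℕ → ℕ → ℕ → ℕ
cc k π a = if a ≤ᵇ k * π then 2 * a else π * (2 * k + 1) ∸ 2 * (suc k * π ∸ a)

module BlockSums (B : ℕ) where

  ∑-falling : B * B ≤ 2 * ∑ B (λ s → B ∸ s)
  ∑-falling = begin
      B * B
    ≡⟨ sym (2∑-descending B) ⟩
      2 * ∑ B (λ s → B ∸ suc s) + B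
    ≤⟨ m≤m+n _ B ⟩
      2 * ∑ B (λ s → B ∸ suc s) + B + B
    ≡⟨ shuffle (∑ B (λ s → B ∸ suc s)) B ⟩
      2 * (∑ B (λ s → B ∸ suc s) + B * 1)
    ≡⟨ cong (2 *_) (trans (cong (∑ B (λ s → B ∸ suc s) +_) (sym (∑-const B 1))) (sym (∑-+ B _ _))) ⟩
      2 * ∑ B (λ s → B ∸ suc s + 1)
    ≡⟨ cong (2 *_) (∑-cong B λ s s<B → trans (+-comm _ 1) (sym (+-∸-assoc 1 s<B))) ⟩
      2 * ∑ B (λ s → B ∸ s) ∎
    where
    open ≤-Reasoning
    shuffle : ∀ x b → 2 * x + b + b ≡ 2 * (x + b * 1)
    shuffle = solve-∀

  ∑-rising : B * B ≤ 2 * ∑ B suc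
  ∑-rising = go B
    where
    expand : ∀ n → n * n + 2 * suc n ≡ suc n * suc n + 1
    expand = solve-∀
    go : ∀ n → n * n ≤ 2 * ∑ n suc
    go zero = z≤n
    go (suc n) = ≤-trans (m≤m+n (suc n * suc n) 1) (≤-trans (≤-reflexive (sym (expand n)))
      (≤-trans (+-monoˡ-≤ (2 * suc n) (go n)) (≤-reflexive (sym (*-distribˡ-+ 2 (∑ n suc) (suc n))))))

  linear-block : ∀ c k (g : ℕ → ℕ) → B * B ≤ 2 * ∑ B g →
    B * B * (c * (2 * k + 1)) ≤ 2 * ∑ B (λ s → c * (k * B + g s))
  linear-block c k g h = begin
      B * B * (c * (2 * k + 1))
    ≡⟨ left B c k ⟩
      c * (2 * (B * (k * B)) + B * B)
    ≤⟨ *-monoʳ-≤ c (+-monoʳ-≤ (2 * (B * (k * B))) h) ⟩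
      c * (2 * (B * (k * B)) + 2 * ∑ B g)
    ≡⟨ right c (B * (k * B)) (∑ B g) ⟩
      2 * (c * (B * (k * B) + ∑ B g))
    ≡⟨ cong (λ z → 2 * (c * z)) (trans (cong (_+ ∑ B g) (sym (∑-const B (k * B)))) (sym (∑-+ B _ g))) ⟩
      2 * (c * ∑ B (λ s → k * B + g s))
    ≡⟨ cong (2 *_) (sym (∑-* B c _)) ⟩
      2 * ∑ B (λ s → c * (k * B + g s)) ∎
    where
    open ≤-Reasoning
    left : ∀ b c k → b * b * (c * (2 * k + 1)) ≡ c * (2 * (b * (k * b)) + b * b)
    left = solve-∀
    right : ∀ c x y → c * (2 * x + 2 * y) ≡ 2 * (c * (x + y))
    right = solve-∀

  constant-block : ∀ c → B * B * (2 * c) ≡ 2 * ∑ B (λ _ → B * c)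
  constant-block c = trans (expand B c) (cong (2 *_) (sym (∑-const B (B * c))))
    where
    expand : ∀ b c → b * b * (2 * c) ≡ 2 * (b * (b * c))
    expand = solve-∀

  falling-≤ : ∀ k s → k * B + (B ∸ s) ≤ suc k * B
  falling-≤ k s = ≤-trans (+-monoʳ-≤ (k * B) (m∸n≤m B s)) (≤-reflexive (+-comm (k * B) B))

  cc-block : ∀ k π a → B * B * cc k π a ≤ 2 * ∑ B (λ s → (π * (k * B + (B ∸ s))) ⊓ (B * a))
  cc-block k π a with a ≤ᵇ k * π in eq
  ... | true = ≤-trans (≤-reflexive (constant-block a)) (*-monoʳ-≤ 2 (∑-mono B λ s _ → ⊓-glb (low s) ≤-refl))
    where
    a≤kπ : a ≤ k * π
    a≤kπ = ≤ᵇ⇒≤ a (k * π) (subst Bool.T (sym eq) tt)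
    shuffle : ∀ b k π → b * (k * π) ≡ π * (k * b)
    shuffle = solve-∀
    low : ∀ s → B * a ≤ π * (k * B + (B ∸ s))
    low s = ≤-trans (*-monoʳ-≤ B a≤kπ) (≤-trans (≤-reflexive (shuffle B k π)) (*-monoʳ-≤ π (m≤m+n (k * B) (B ∸ s))))
  ... | false = begin
      B * B * (π * (2 * k + 1) ∸ 2 * δ)
    ≡⟨ *-distribˡ-∸ (B * B) (π * (2 * k + 1)) (2 * δ) ⟩
      B * B * (π * (2 * k + 1)) ∸ B * B * (2 * δ)
    ≤⟨ m≤n+o⇒m∸n≤o _ (B * B * (2 * δ)) (begin
        B * B * (π * (2 * k + 1))
      ≤⟨ linear-block π k (λ s → B ∸ s) ∑-falling ⟩
        2 * ∑ B (λ s → π * (k * B + (B ∸ s)))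
      ≤⟨ *-monoʳ-≤ 2 (∑-mono B λ s _ → pointwise s) ⟩
        2 * ∑ B (λ s → B * δ + ((π * (k * B + (B ∸ s))) ⊓ (B * a)))
      ≡⟨ trans (cong (2 *_) (∑-+ B _ _)) (*-distribˡ-+ 2 (∑ B (λ _ → B * δ)) _) ⟩
        2 * ∑ B (λ _ → B * δ) + 2 * ∑ B (λ s → (π * (k * B + (B ∸ s))) ⊓ (B * a))
      ≡⟨ cong (_+ 2 * ∑ B (λ s → (π * (k * B + (B ∸ s))) ⊓ (B * a))) (sym (constant-block δ)) ⟩
        B * B * (2 * δ) + 2 * ∑ B (λ s → (π * (k * B + (B ∸ s))) ⊓ (B * a)) ∎) ⟩
      2 * ∑ B (λ s → (π * (k * B + (B ∸ s))) ⊓ (B * a)) ∎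
    where
    open ≤-Reasoning
    δ = suc k * π ∸ a
    pointwise : ∀ s → π * (k * B + (B ∸ s)) ≤ B * δ + ((π * (k * B + (B ∸ s))) ⊓ (B * a))
    pointwise s = ≤-trans (⊓-glb (m≤n+m _ (B * δ)) (begin
        π * (k * B + (B ∸ s))
      ≤⟨ *-monoʳ-≤ π (falling-≤ k s) ⟩
        π * (suc k * B)
      ≡⟨ shuffle π (suc k) B ⟩
        B * (suc k * π)
      ≤⟨ *-monoʳ-≤ B (m≤n+m∸n (suc k * π) a) ⟩
        B * (a + δ)
      ≡⟨ trans (*-distribˡ-+ B a δ) (+-comm (B * a) (B * δ)) ⟩
        B * δ + B * a ∎)) (≤-reflexive (sym (+-distribˡ-⊓ (B * δ) _ (B * a))))
      where
      shuffle : ∀ π k b → π * (k * b) ≡ b * (k * π)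
      shuffle = solve-∀

-- The shares are constant on each of K blocks of B ranks; hitScore and noHitScore
-- bound, in units of B² / 2, what the row sums H, lowerRow and upperRow are worth.
module BlockShares (K S : ℕ) (F P : ℕ → ℕ) (F≤P : ∀ j → F j ≤ P j) (F+P≡S : ∀ j → F j + P j ≡ S) where

  after : ℕ → ℕ
  after j = K ∸ suc j

  firstScore : ℕ → ℕ
  firstScore j = 2 * F j * (2 * after j + 1)

  secondScore : ℕ → ℕ → ℕ
  secondScore T j = j * F j + ∑ (T ∸ j) (λ i → F (j + i)) + (K ∸ T) * P T

  hitScore : ℕ → ℕ
  hitScore T = ∑ T (λ j → firstScore j + cc (after j) (P j) (secondScore T j)) + 2 * ((K ∸ T) * (K ∸ T) * P T)

  lowerScore : ℕ → ℕ
  lowerScore j = firstScore j + 2 * F j * (2 * j + 1)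

  -- The threshold θ may fall anywhere inside block Θ. The minimum of the value of a row below θ and
  -- of a row above it makes the estimate independent of that position; each value is already
  -- reduced to one valid for the whole block.
  middleScore : ℕ → ℕ
  middleScore Θ = (2 * (Θ * F Θ)) ⊓ (after Θ * P Θ + ((after Θ * P Θ) ⊓ (Θ * F Θ)))

  upperScore : ℕ → ℕ → ℕ
  upperScore Θ j = firstScore j + (P j * (2 * after j + 1) + cc (after j) (P j) (Θ * F j))

  noHitScore : ℕ → ℕ
  noHitScore Θ = ∑ Θ lowerScore + (firstScore Θ + 2 * middleScore Θ) + ∑ (after Θ) (λ i → upperScore Θ (suc Θ + i))

  module Refined (B : ℕ) .{{_ : NonZero B}} where

    open BlockSums B

    N : ℕ
    N = K * B

    f p : ℕ → ℕ
    f x = F (x / B)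
    p x = P (x / B)

    open Shares S f p (λ x → F≤P (x / B)) (λ x → F+P≡S (x / B)) N public

    block : ∀ j {s} → s < B → (j * B + s) / B ≡ j
    block j {s} s<B = trans (+-distrib-/-∣ˡ s (n∣m*n j))
      (trans (cong₂ _+_ (m*n/n≡m j B) (m<n⇒m/n≡0 s<B)) (+-identityʳ j))

    N∸ : ∀ j {s} → j < K → s < B → N ∸ (j * B + s) ≡ after j * B + (B ∸ s)
    N∸ j {s} j<K s<B = begin
        K * B ∸ (j * B + s)
      ≡⟨ cong (λ m → m * B ∸ (j * B + s)) (trans (sym (m+[n∸m]≡n j<K)) (sym (+-suc j (after j)))) ⟩
        (j + suc (after j)) * B ∸ (j * B + s)
      ≡⟨ cong (_∸ (j * B + s)) (*-distribʳ-+ B j (suc (after j))) ⟩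
        j * B + (B + after j * B) ∸ (j * B + s)
      ≡⟨ [m+n]∸[m+o]≡n∸o (j * B) _ s ⟩
        (B + after j * B) ∸ s
      ≡⟨ +-∸-comm (after j * B) (<⇒≤ s<B) ⟩
        B ∸ s + after j * B
      ≡⟨ +-comm (B ∸ s) _ ⟩
        after j * B + (B ∸ s) ∎
      where open ≡-Reasoning

    sum-of-two : ∀ {x y} {g h : ℕ → ℕ} → B * B * x ≤ 2 * ∑ B g → B * B * y ≤ 2 * ∑ B h →
      B * B * (x + y) ≤ 2 * ∑ B (λ s → g s + h s)
    sum-of-two {x} {y} {g} {h} a b = begin
        B * B * (x + y)
      ≡⟨ *-distribˡ-+ (B * B) x y ⟩
        B * B * x + B * B * y
      ≤⟨ +-mono-≤ a b ⟩
        2 * ∑ B g + 2 * ∑ B h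
      ≡⟨ trans (sym (*-distribˡ-+ 2 (∑ B g) _)) (cong (2 *_) (sym (∑-+ B g h))) ⟩
        2 * ∑ B (λ s → g s + h s) ∎
      where open ≤-Reasoning

    sum-of-blocks : ∀ T (score : ℕ → ℕ) (g : ℕ → ℕ) →
      (∀ j → j < T → B * B * score j ≤ 2 * ∑ B (λ s → g (j * B + s))) →
      B * B * ∑ T score ≤ 2 * ∑ (T * B) g
    sum-of-blocks T score g h = begin
        B * B * ∑ T score
      ≡⟨ sym (∑-* T (B * B) score) ⟩
        ∑ T (λ j → B * B * score j)
      ≤⟨ ∑-mono T h ⟩
        ∑ T (λ j → 2 * ∑ B (λ s → g (j * B + s)))
      ≡⟨ trans (∑-* T 2 _) (cong (2 *_) (sym (∑-blocks T B g))) ⟩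
        2 * ∑ (T * B) g ∎
      where open ≤-Reasoning

    first-block : ∀ j → B * B * firstScore j ≤ 2 * ∑ B (λ s → 2 * F j * (after j * B + (B ∸ s)))
    first-block j = linear-block (2 * F j) (after j) (λ s → B ∸ s) ∑-falling

    -- Moving forward by s inside block j gains s ranks behind and loses s ranks ahead, all with the
    -- same share `F j`. So `arm₂` does not vary inside the block, and a single score serves for all
    -- of it.
    arm₂-block : ∀ T j {s} → j < T → s < B → B * secondScore T j ≤ arm₂ (T * B) (P T) (j * B + s)
    arm₂-block T j {s} j<T s<B = begin
        B * (j * F j + G + (K ∸ T) * P T)
      ≡⟨ expand B j (F j) G (K ∸ T) (P T) ⟩
        j * B * F j + B * G + (K ∸ T) * B * P T
      ≡⟨ cong₂ (λ a b → j * B * F j + a + b * P T) BG (*-distribʳ-∸ B K T) ⟩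
        j * B * F j + (s * F j + rest) + (N ∸ T * B) * P T
      ≤⟨ +-monoˡ-≤ ((N ∸ T * B) * P T) (m≤m+n (j * B * F j + (s * F j + rest)) (F j)) ⟩
        j * B * F j + (s * F j + rest) + F j + (N ∸ T * B) * P T
      ≡⟨ collect (j * B) s (F j) rest ((N ∸ T * B) * P T) ⟩
        suc (j * B + s) * F j + rest + (N ∸ T * B) * P T
      ≡⟨ cong (λ k → suc (j * B + s) * F k + rest + (N ∸ T * B) * P T) (sym (block j s<B)) ⟩
        arm₂ (T * B) (P T) (j * B + s) ∎
      where
      open ≤-Reasoning
      r = T ∸ j
      G = ∑ r (λ i → F (j + i))
      rest = ∑ (T * B ∸ (j * B + s)) (λ d → f (j * B + s + d))
      expand : ∀ b j φ g k π → b * (j * φ + g + k * π) ≡ j * b * φ + b * g + k * b * π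
      expand = solve-∀
      collect : ∀ x s φ r q → x * φ + (s * φ + r) + φ + q ≡ suc (x + s) * φ + r + q
      collect = solve-∀
      TB≡ : T * B ≡ j * B + r * B
      TB≡ = trans (cong (_* B) (sym (m+[n∸m]≡n (<⇒≤ j<T)))) (*-distribʳ-+ B j r)
      s≤rB : s ≤ r * B
      s≤rB = ≤-trans (<⇒≤ s<B) (m≤n*m B r {{>-nonZero (m<n⇒0<n∸m j<T)}})
      BG : B * G ≡ s * F j + rest
      BG = ≡R.begin
          B * G
        ≡R.≡⟨ sym (∑-* r B _) ⟩
          ∑ r (λ i → B * F (j + i))
        ≡R.≡⟨ ∑-cong r (λ i _ → trans (sym (∑-const B (F (j + i)))) (∑-cong B λ d d<B →
              cong F (trans (sym (block (j + i) d<B)) (cong (_/ B)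
                (trans (cong (_+ d) (*-distribʳ-+ B j i)) (+-assoc (j * B) (i * B) d)))))) ⟩
          ∑ r (λ i → ∑ B (λ d → f (j * B + (i * B + d))))
        ≡R.≡⟨ sym (∑-blocks r B (λ d → f (j * B + d))) ⟩
          ∑ (r * B) (λ d → f (j * B + d))
        ≡R.≡⟨ cong (λ m → ∑ m (λ d → f (j * B + d))) (sym (m+[n∸m]≡n s≤rB)) ⟩
          ∑ (s + (r * B ∸ s)) (λ d → f (j * B + d))
        ≡R.≡⟨ ∑-split s (r * B ∸ s) _ ⟩
          ∑ s (λ d → f (j * B + d)) + ∑ (r * B ∸ s) (λ d → f (j * B + (s + d)))
        ≡R.≡⟨ cong₂ _+_
              (trans (∑-cong s λ d d<s → cong F (block j (<-trans d<s s<B))) (∑-const s (F j)))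
              (trans (∑-cong (r * B ∸ s) λ d _ → cong f (sym (+-assoc (j * B) s d)))
                     (cong (λ m → ∑ m (λ d → f (j * B + s + d)))
                       (sym (trans (cong (_∸ (j * B + s)) TB≡) ([m+n]∸[m+o]≡n∸o (j * B) (r * B) s))))) ⟩
          s * F j + rest ≡R.∎
        where module ≡R = ≡-Reasoning

    hit-block : ∀ T → T < K → B * B * hitScore T ≤ 2 * H (T * B) (P T)
    hit-block T T<K = begin
        B * B * (∑ T (λ j → firstScore j + cc (after j) (P j) (secondScore T j)) + 2 * ((K ∸ T) * (K ∸ T) * P T))
      ≡⟨ *-distribˡ-+ (B * B) (∑ T _) _ ⟩
        B * B * ∑ T (λ j → firstScore j + cc (after j) (P j) (secondScore T j)) + B * B * (2 * ((K ∸ T) * (K ∸ T) * P T))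
      ≤⟨ +-mono-≤ (sum-of-blocks T _ _ row-block) (≤-reflexive corner) ⟩
        2 * ∑ (T * B) (λ y → 2 * f y * (N ∸ y) + (arm₁ y ⊓ arm₂ (T * B) (P T) y)) + 2 * ((N ∸ T * B) * (N ∸ T * B) * P T)
      ≡⟨ sym (*-distribˡ-+ 2 (∑ (T * B) _) _) ⟩
        2 * H (T * B) (P T) ∎
      where
      open ≤-Reasoning
      shuffle : ∀ b k π → b * b * (2 * (k * k * π)) ≡ 2 * (k * b * (k * b) * π)
      shuffle = solve-∀
      corner : B * B * (2 * ((K ∸ T) * (K ∸ T) * P T)) ≡ 2 * ((N ∸ T * B) * (N ∸ T * B) * P T)
      corner = trans (shuffle B (K ∸ T) (P T)) (cong (λ m → 2 * (m * m * P T)) (*-distribʳ-∸ B K T))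
      row-block : ∀ j → j < T → B * B * (firstScore j + cc (after j) (P j) (secondScore T j))
        ≤ 2 * ∑ B (λ s → 2 * f (j * B + s) * (N ∸ (j * B + s)) + (arm₁ (j * B + s) ⊓ arm₂ (T * B) (P T) (j * B + s)))
      row-block j j<T = ≤-trans (sum-of-two (first-block j) (cc-block (after j) (P j) (secondScore T j)))
        (*-monoʳ-≤ 2 (∑-mono B λ s s<B → +-mono-≤
          (≤-reflexive (cong₂ (λ a b → 2 * F a * b) (sym (block j s<B)) (sym (N∸ j (<-trans j<T T<K) s<B))))
          (⊓-mono-≤ (≤-reflexive (cong₂ (λ a b → P a * b) (sym (block j s<B)) (sym (N∸ j (<-trans j<T T<K) s<B))))
            (arm₂-block T j j<T s<B))))

    -- The passive share is frozen at `P T` even for `s` equal to `B`: the first argument of `H` is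
    -- one more than the rank of the hit, which then still lies in block T. The condition for the
    -- block implies that of `H-step` at each of its ranks, because at least `after T * B` ranks
    -- remain.
    H-climb : ∀ T → T < K → K * P T ≤ (K + after T) * F T →
      ∀ s → s ≤ B → H (T * B) (P T) ≤ H (T * B + s) (P T)
    H-climb T T<K cond zero _ = ≤-reflexive (cong (λ t → H t (P T)) (sym (+-identityʳ (T * B))))
    H-climb T T<K cond (suc s) s<B = ≤-trans (H-climb T T<K cond s (<⇒≤ s<B))
      (subst₂ _≤_ (cong (λ k → H t (P k)) (block T s<B))
        (cong₂ (λ t′ k → H t′ (P k)) (sym (+-suc (T * B) s)) (block T s<B))
        (H-step t t<N cond′))
      where
      t = T * B + s
      t<N : t < N
      t<N = ≤-trans (+-monoʳ-< (T * B) s<B) (≤-trans (≤-reflexive (+-comm (T * B) B)) (*-monoˡ-≤ B T<K))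
      expand : ∀ k b x → k * b * x ≡ k * x * b
      expand = solve-∀
      expand′ : ∀ k a b x → (k + a) * x * b ≡ (k * b + a * b) * x
      expand′ = solve-∀
      cond′ : N * p t ≤ (N + (N ∸ t)) * f t
      cond′ = subst₂ (λ a b → N * P a ≤ (N + b) * F a) (sym (block T s<B)) (sym (N∸ T T<K s<B)) (begin
          K * B * P T
        ≡⟨ expand K B (P T) ⟩
          K * P T * B
        ≤⟨ *-monoˡ-≤ B cond ⟩
          (K + after T) * F T * B
        ≡⟨ expand′ K (after T) B (F T) ⟩
          (K * B + after T * B) * F T
        ≤⟨ *-monoˡ-≤ (F T) (+-monoʳ-≤ (K * B) (m≤m+n (after T * B) (B ∸ s))) ⟩
          (K * B + (after T * B + (B ∸ s))) * F T ∎)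
        where open ≤-Reasoning

    split-rank : ∀ t → t ≡ t / B * B + t % B
    split-rank t = trans (m≡m%n+[m/n]*n t B) (+-comm (t % B) _)

    hit-score : ∀ {c} → (∀ {T} → T < K → c ≤ hitScore T) → (∀ {T} → T < K → K * P T ≤ (K + after T) * F T) →
      ∀ t → t < N → B * B * c ≤ 2 * H (suc t) (p t)
    hit-score {c} scores conds t t<N = begin
        B * B * c
      ≤⟨ *-monoʳ-≤ (B * B) (scores T<K) ⟩
        B * B * hitScore T
      ≤⟨ hit-block T T<K ⟩
        2 * H (T * B) (P T)
      ≤⟨ *-monoʳ-≤ 2 (H-climb T T<K (conds T<K) (suc (t % B)) (m%n<n t B)) ⟩
        2 * H (T * B + suc (t % B)) (P T)
      ≡⟨ cong (λ m → 2 * H m (P T)) (trans (+-suc (T * B) (t % B)) (cong suc (sym (split-rank t)))) ⟩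
        2 * H (suc t) (p t) ∎
      where
      open ≤-Reasoning
      T = t / B
      T<K : T < K
      T<K = m<n*o⇒m/o<n t<N

    lower-block : ∀ j → j < K → B * B * lowerScore j ≤ 2 * ∑ B (λ s → lowerRow (j * B + s))
    lower-block j j<K = ≤-trans (sum-of-two (first-block j) (linear-block (2 * F j) j suc ∑-rising))
      (*-monoʳ-≤ 2 (∑-mono B λ s s<B → +-mono-≤
        (≤-reflexive (cong₂ (λ a b → 2 * F a * b) (sym (block j s<B)) (sym (N∸ j j<K s<B))))
        (≤-reflexive (trans (shuffle (F j) (j * B) s) (cong (λ a → 2 * suc (j * B + s) * F a) (sym (block j s<B)))))))
      where
      shuffle : ∀ φ x s → 2 * φ * (x + suc s) ≡ 2 * suc (x + s) * φ
      shuffle = solve-∀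

    module Straddling (Θ r : ℕ) (Θ<K : Θ < K) (r<B : r < B) where
      open ≤-Reasoning

      θ k : ℕ
      θ = Θ * B + r
      k = after Θ

      middleRow : ℕ → ℕ
      middleRow s = 2 * F Θ * (k * B + (B ∸ s)) + B * middleScore Θ

      first-part : ∀ j {s} → j < K → s < B → 2 * F j * (after j * B + (B ∸ s)) ≡ 2 * f (j * B + s) * (N ∸ (j * B + s))
      first-part j j<K s<B = cong₂ (λ a b → 2 * F a * b) (sym (block j s<B)) (sym (N∸ j j<K s<B))

      middle-lower : ∀ s → s < B → middleRow s ≤ lowerRow (Θ * B + s)
      middle-lower s s<B = +-mono-≤ (≤-reflexive (first-part Θ Θ<K s<B)) (begin
          B * middleScore Θ
        ≤⟨ *-monoʳ-≤ B (m⊓n≤m (2 * (Θ * F Θ)) _) ⟩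
          B * (2 * (Θ * F Θ))
        ≡⟨ shuffle B Θ (F Θ) ⟩
          2 * (Θ * B) * F Θ
        ≤⟨ *-monoˡ-≤ (F Θ) (*-monoʳ-≤ 2 (≤-trans (m≤m+n (Θ * B) s) (n≤1+n _))) ⟩
          2 * suc (Θ * B + s) * F Θ
        ≡⟨ cong (λ a → 2 * suc (Θ * B + s) * F a) (sym (block Θ s<B)) ⟩
          2 * suc (Θ * B + s) * f (Θ * B + s) ∎)
        where
        shuffle : ∀ b t φ → b * (2 * (t * φ)) ≡ 2 * (t * b) * φ
        shuffle = solve-∀

      arm₁-block : ∀ j {s} → j < K → s < B → P j * (after j * B + (B ∸ s)) ≡ arm₁ (j * B + s)
      arm₁-block j j<K s<B = cong₂ (λ a b → P a * b) (sym (block j s<B)) (sym (N∸ j j<K s<B))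

      B*after≤arm₁ : ∀ j {s} → j < K → s < B → B * (after j * P j) ≤ arm₁ (j * B + s)
      B*after≤arm₁ j {s} j<K s<B = begin
          B * (after j * P j)
        ≡⟨ shuffle B (after j) (P j) ⟩
          P j * (after j * B)
        ≤⟨ *-monoʳ-≤ (P j) (m≤m+n (after j * B) (B ∸ s)) ⟩
          P j * (after j * B + (B ∸ s))
        ≡⟨ arm₁-block j j<K s<B ⟩
          arm₁ (j * B + s) ∎
        where
        shuffle : ∀ b k π → b * (k * π) ≡ π * (k * b)
        shuffle = solve-∀

      θ-share : ∀ j {s} → s < B → B * (Θ * F j) ≤ θ * f (j * B + s)
      θ-share j {s} s<B = begin
          B * (Θ * F j)
        ≡⟨ shuffle B Θ (F j) ⟩
          Θ * B * F j
        ≤⟨ *-monoˡ-≤ (F j) (m≤m+n (Θ * B) r) ⟩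
          θ * F j
        ≡⟨ cong (λ a → θ * F a) (sym (block j s<B)) ⟩
          θ * f (j * B + s) ∎
        where
        shuffle : ∀ b t φ → b * (t * φ) ≡ t * b * φ
        shuffle = solve-∀

      middle-upper : ∀ s → s < B → middleRow s ≤ upperRow θ (Θ * B + s)
      middle-upper s s<B = +-mono-≤ (≤-reflexive (first-part Θ Θ<K s<B)) (begin
          B * middleScore Θ
        ≤⟨ *-monoʳ-≤ B (m⊓n≤n (2 * (Θ * F Θ)) _) ⟩
          B * (k * P Θ + ((k * P Θ) ⊓ (Θ * F Θ)))
        ≡⟨ trans (*-distribˡ-+ B (k * P Θ) _) (cong (B * (k * P Θ) +_) (*-distribˡ-⊓ B (k * P Θ) (Θ * F Θ))) ⟩
          B * (k * P Θ) + ((B * (k * P Θ)) ⊓ (B * (Θ * F Θ)))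
        ≤⟨ +-mono-≤ (B*after≤arm₁ Θ Θ<K s<B) (⊓-mono-≤ (B*after≤arm₁ Θ Θ<K s<B) (θ-share Θ s<B)) ⟩
          arm₁ (Θ * B + s) + (arm₁ (Θ * B + s) ⊓ (θ * f (Θ * B + s))) ∎)

      upper-block : ∀ i → i < k →
        B * B * upperScore Θ (suc Θ + i) ≤ 2 * ∑ B (λ s → upperRow θ (suc Θ * B + (i * B + s)))
      upper-block i i<k = ≤-trans
        (sum-of-two (first-block j) (sum-of-two (linear-block (P j) (after j) (λ s → B ∸ s) ∑-falling) (cc-block (after j) (P j) (Θ * F j))))
        (*-monoʳ-≤ 2 (∑-mono B λ s s<B → ≤-trans (+-mono-≤
          (≤-reflexive (first-part j j<K s<B))
          (+-mono-≤ (≤-reflexive (arm₁-block j j<K s<B))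
            (⊓-mono-≤ (≤-reflexive (arm₁-block j j<K s<B)) (θ-share j s<B))))
          (≤-reflexive (cong (upperRow θ) (trans (cong (_+ s) (*-distribʳ-+ B (suc Θ) i)) (+-assoc (suc Θ * B) (i * B) s))))))
        where
        j = suc Θ + i
        j<K : j < K
        j<K = ≤-trans (+-monoʳ-< (suc Θ) i<k) (≤-reflexive (m+[n∸m]≡n Θ<K))

      rows-above : N ∸ θ ≡ (B ∸ r) + k * B
      rows-above = trans (N∸ Θ Θ<K r<B) (+-comm (k * B) (B ∸ r))

      no-hit-blocks : B * B * noHitScore Θ ≤
        2 * (∑ θ lowerRow + ∑ (N ∸ θ) (λ d → upperRow θ (θ + d)))
      no-hit-blocks = begin
          B * B * (∑ Θ lowerScore + (firstScore Θ + 2 * middleScore Θ) + ∑ k (λ i → upperScore Θ (suc Θ + i)))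
        ≡⟨ trans (*-distribˡ-+ (B * B) _ _) (cong (_+ B * B * ∑ k (λ i → upperScore Θ (suc Θ + i))) (*-distribˡ-+ (B * B) (∑ Θ lowerScore) _)) ⟩
          B * B * ∑ Θ lowerScore + B * B * (firstScore Θ + 2 * middleScore Θ) + B * B * ∑ k (λ i → upperScore Θ (suc Θ + i))
        ≤⟨ +-mono-≤ (+-mono-≤
             (sum-of-blocks Θ lowerScore lowerRow λ j j<Θ → lower-block j (<-trans j<Θ Θ<K))
             (≤-trans (sum-of-two (first-block Θ) (≤-reflexive (constant-block (middleScore Θ)))) (*-monoʳ-≤ 2 middle)))
             (sum-of-blocks k (λ i → upperScore Θ (suc Θ + i)) (λ d → upperRow θ (suc Θ * B + d)) upper-block) ⟩
          2 * L + 2 * (M₁ + M₂) + 2 * U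
        ≡⟨ shuffle L M₁ M₂ U ⟩
          2 * ((L + M₁) + (M₂ + U))
        ≡⟨ cong₂ (λ a b → 2 * (a + b)) (sym (∑-split (Θ * B) r lowerRow))
             (sym (trans (cong (λ m → ∑ m (λ d → upperRow θ (θ + d))) rows-above)
               (trans (∑-split (B ∸ r) (k * B) _) (cong₂ _+_
                 (∑-cong (B ∸ r) λ d _ → cong (upperRow θ) (+-assoc (Θ * B) r d))
                 (∑-cong (k * B) λ d _ → cong (upperRow θ) (next d)))))) ⟩
          2 * (∑ θ lowerRow + ∑ (N ∸ θ) (λ d → upperRow θ (θ + d))) ∎
        where
        L = ∑ (Θ * B) lowerRow
        M₁ = ∑ r (λ s → lowerRow (Θ * B + s))
        M₂ = ∑ (B ∸ r) (λ d → upperRow θ (Θ * B + (r + d)))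
        U = ∑ (k * B) (λ d → upperRow θ (suc Θ * B + d))
        shuffle : ∀ l a b u → 2 * l + 2 * (a + b) + 2 * u ≡ 2 * ((l + a) + (b + u))
        shuffle = solve-∀
        next : ∀ d → θ + (B ∸ r + d) ≡ suc Θ * B + d
        next d = trans (sym (+-assoc θ (B ∸ r) d)) (cong (_+ d)
          (trans (+-assoc (Θ * B) r (B ∸ r)) (trans (cong (Θ * B +_) (m+[n∸m]≡n (<⇒≤ r<B))) (+-comm (Θ * B) B))))
        middle : ∑ B middleRow ≤ M₁ + M₂
        middle = begin
            ∑ B middleRow
          ≡⟨ trans (cong (λ m → ∑ m middleRow) (sym (m+[n∸m]≡n (<⇒≤ r<B)))) (∑-split r (B ∸ r) middleRow) ⟩
            ∑ r middleRow + ∑ (B ∸ r) (λ d → middleRow (r + d))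
          ≤⟨ +-mono-≤ (∑-mono r λ s s<r → middle-lower s (<-trans s<r r<B))
               (∑-mono (B ∸ r) λ d d< → middle-upper (r + d) (≤-trans (+-monoʳ-< r d<) (≤-reflexive (m+[n∸m]≡n (<⇒≤ r<B))))) ⟩
            M₁ + M₂ ∎

    no-hit-score : ∀ {c} → (∀ {Θ} → Θ < K → c ≤ noHitScore Θ) → c ≤ ∑ K lowerScore →
      ∀ θ → θ ≤ N → B * B * c ≤ 2 * (∑ θ lowerRow + ∑ (N ∸ θ) (λ d → upperRow θ (θ + d)))
    no-hit-score {c} scores last θ θ≤N with θ <? N
    ... | yes θ<N = subst (λ t → B * B * c ≤ 2 * (∑ t lowerRow + ∑ (N ∸ t) (λ d → upperRow t (t + d))))
      (sym (split-rank θ))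
      (≤-trans (*-monoʳ-≤ (B * B) (scores Θ<K)) (Straddling.no-hit-blocks (θ / B) (θ % B) Θ<K (m%n<n θ B)))
      where
      Θ<K : θ / B < K
      Θ<K = m<n*o⇒m/o<n θ<N
    -- The value N of θ encodes that neither endpoint ever would choose the other.
    ... | no θ≮N with ≤-antisym θ≤N (≮⇒≥ θ≮N)
    ... | refl = begin
        B * B * c
      ≤⟨ *-monoʳ-≤ (B * B) last ⟩
        B * B * ∑ K lowerScore
      ≤⟨ sum-of-blocks K lowerScore lowerRow lower-block ⟩
        2 * ∑ N lowerRow
      ≤⟨ *-monoʳ-≤ 2 (m≤m+n (∑ N lowerRow) _) ⟩
        2 * (∑ N lowerRow + ∑ (N ∸ N) (λ d → upperRow N (N + d))) ∎
      where open ≤-Reasoning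

-- The process, and its comparison with a run in which one vertex waits

not-both : ∀ {a b c : Bool} → a ≢ b → b ≢ c → a ≡ c
not-both {false} {false} a≢b _ = ⊥-elim (a≢b refl)
not-both {true} {true} a≢b _ = ⊥-elim (a≢b refl)
not-both {false} {true} {false} _ _ = refl
not-both {false} {true} {true} _ b≢c = ⊥-elim (b≢c refl)
not-both {true} {false} {true} _ _ = refl
not-both {true} {false} {false} _ b≢c = ⊥-elim (b≢c refl)

module Process {n : ℕ} (G : SimpleGraph n) (pref : Fin n → List (Fin n)) (order : ∀ u → IsPrefOrder u (pref u)) where
  open RDO G pref

  Free : State → Fin n → Set
  Free s v = s v ≡ nothing

  free? : ∀ s v → Dec (Free s v)
  free? s v with s v
  ... | nothing = yes refl
  ... | just _ = no λ ()

  partner : State → Fin n → Maybe (Fin n)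
  partner s w = maybe′ (λ _ → nothing) (choose s w (pref w)) (s w)

  act : State → Fin n → State
  act s w = maybe′ (assign s w) s (partner s w)

  adj-sym : ∀ {u v} → Adj G u v ≡ true → Adj G v u ≡ true
  adj-sym {u} {v} a = trans (symmetric G v u) a

  adj-irrefl : ∀ {u v} → Adj G u v ≡ true → u ≢ v
  adj-irrefl {u} a refl with trans (sym a) (irreflexive G u)
  ... | ()

  choose-just : ∀ s u l {z} → choose s u l ≡ just z → Adj G u z ≡ true × Free s z
  choose-just s u (v ∷ l) eq with Adj G u v in a | s v in f
  ... | true | nothing with refl ← eq = a , f
  ... | true | just _ = choose-just s u l eq
  ... | false | _ = choose-just s u l eq

  choose-exists : ∀ s u l {v} → v ∈ l → Adj G u v ≡ true → Free s v → ∃[ z ] choose s u l ≡ just z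
  choose-exists s u (_ ∷ l) (here refl) a f rewrite a | f = _ , refl
  choose-exists s u (x ∷ l) (there v∈l) a f with Adj G u x ∧ is-nothing (s x)
  ... | true = _ , refl
  ... | false = choose-exists s u l v∈l a f

  -- Revealed preference: if the choices differed, the one listed earlier would be free in the state
  -- that passed over it.
  choose-agree : ∀ s s′ u l {z z′} → choose s u l ≡ just z → choose s′ u l ≡ just z′ →
    Free s′ z → Free s z′ → z ≡ z′
  choose-agree s s′ u (v ∷ l) eq eq′ f′ f with Adj G u v | s v in e | s′ v in e′
  ... | false | _ | _ = choose-agree s s′ u l eq eq′ f′ f
  ... | true | nothing | nothing = trans (sym (just-injective eq)) (just-injective eq′)
  ... | true | just _ | just _ = choose-agree s s′ u l eq eq′ f′ f
  ... | true | nothing | just _ with refl ← eq with () ← trans (sym f′) e′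
  ... | true | just _ | nothing with refl ← eq′ with () ← trans (sym f) e

  partner-just : ∀ s w {z} → partner s w ≡ just z → Free s w × choose s w (pref w) ≡ just z
  partner-just s w eq with s w
  ... | nothing = refl , eq

  partner-free : ∀ s w {z} → partner s w ≡ just z → Free s w × Free s z × Adj G w z ≡ true
  partner-free s w eq with fw , ch ← partner-just s w eq with a , fz ← choose-just s w (pref w) ch = fw , fz , a

  partner-choose : ∀ s w → Free s w → partner s w ≡ choose s w (pref w)
  partner-choose s w f rewrite f = refl

  partner-exists : ∀ s w {z} → Free s w → Adj G w z ≡ true → Free s z → ∃[ z′ ] partner s w ≡ just z′
  partner-exists s w {z} fw a fz with choose-exists s w (pref w) (proj₂ (proj₂ (order w)) z (adj-irrefl a ∘ sym)) a fz
  ... | z′ , eq = z′ , trans (partner-choose s w fw) eq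

  partner-agree : ∀ s s′ w {z z′} → partner s w ≡ just z → partner s′ w ≡ just z′ → Free s′ z → Free s z′ → z ≡ z′
  partner-agree s s′ w e e′ = choose-agree s s′ w (pref w) (proj₂ (partner-just s w e)) (proj₂ (partner-just s′ w e′))

  act-just : ∀ s w {z} → partner s w ≡ just z → act s w ≡ assign s w z
  act-just s w eq rewrite eq = refl

  assign-free⁻ : ∀ s w z v → Free (assign s w z) v → Free s v × v ≢ w × v ≢ z
  assign-free⁻ s w z v f with v ≟ w | v ≟ z
  ... | no v≢w | no v≢z = f , v≢w , v≢z

  assign-free⁺ : ∀ s w z v → Free s v → v ≢ w → v ≢ z → Free (assign s w z) v
  assign-free⁺ s w z v f v≢w v≢z with v ≟ w | v ≟ z
  ... | yes e | _ = ⊥-elim (v≢w e)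
  ... | no _ | yes e = ⊥-elim (v≢z e)
  ... | no _ | no _ = f

  act-free⁻ : ∀ s w {v} → Free (act s w) v → Free s v
  act-free⁻ s w {v} f with partner s w
  ... | nothing = f
  ... | just z = proj₁ (assign-free⁻ s w z v f)

  act-free-≢ : ∀ s w {v z} → Free (act s w) v → partner s w ≡ just z → v ≢ w × v ≢ z
  act-free-≢ s w {v} {z} f eq = proj₂ (assign-free⁻ s w z v (subst (λ t → Free t v) (act-just s w eq) f))

  act-free⁺ : ∀ s w {v} → Free s v → (∀ z → partner s w ≡ just z → v ≢ w × v ≢ z) → Free (act s w) v
  act-free⁺ s w {v} f h with partner s w
  ... | nothing = f
  ... | just z = assign-free⁺ s w z v f (proj₁ (h z refl)) (proj₂ (h z refl))

  act-matched : ∀ s w {v} → Free s v → ¬ Free (act s w) v → ∃[ z ] partner s w ≡ just z × (v ≡ w ⊎ v ≡ z)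
  act-matched s w {v} f ¬f with partner s w in eq
  ... | nothing = ⊥-elim (¬f f)
  ... | just z with v ≟ w | v ≟ z
  ...   | yes e | _ = z , refl , inj₁ e
  ...   | no _ | yes e = z , refl , inj₂ e
  ...   | no _ | no _ = ⊥-elim (¬f f)

  -- An item is a vertex to be processed or, as nothing, the start of the next rank.
  Item : Set
  Item = Maybe (Fin n)

  exec : State → List Item → State
  exec s [] = s
  exec s (nothing ∷ l) = exec s l
  exec s (just w ∷ l) = exec (act s w) l

  exec-++ : ∀ s xs ys → exec s (xs ++ ys) ≡ exec (exec s xs) ys
  exec-++ s [] ys = refl
  exec-++ s (nothing ∷ xs) ys = exec-++ s xs ys
  exec-++ s (just w ∷ xs) ys = exec-++ (act s w) xs ys

  exec-free⁻ : ∀ s l {v} → Free (exec s l) v → Free s v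
  exec-free⁻ s [] f = f
  exec-free⁻ s (nothing ∷ l) f = exec-free⁻ s l f
  exec-free⁻ s (just w ∷ l) f = act-free⁻ s w (exec-free⁻ (act s w) l f)

  module Coupling (colour : Fin n → Bool) (proper : ∀ u v → Adj G u v ≡ true → colour u ≢ colour v) where

    -- How the state s′ of a run in which e has already been matched compares to the
    -- state s of the run in which e waits.
    record Ahead (e : Fin n) (s s′ : State) : Set where
      field
        same : ∀ x → colour x ≡ colour e → x ≢ e → Free s x → Free s′ x
        opposite : ∀ x → colour x ≢ colour e → Free s′ x → Free s x
    open Ahead public

    colour-flip : ∀ {a b e} → Adj G a b ≡ true → colour a ≢ colour e → colour b ≡ colour e
    colour-flip {a} {b} adj a≢e = not-both (proper b a (adj-sym adj)) a≢e

    colour-flip′ : ∀ {a b e} → Adj G a b ≡ true → colour a ≡ colour e → colour b ≢ colour e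
    colour-flip′ {a} {b} adj a≡e b≡e = proper a b adj (trans a≡e (sym b≡e))

    ahead-start : ∀ s e {z} → partner s e ≡ just z → Ahead e s (act s e)
    ahead-start s e {z} eq = record
      { same = λ x cx x≢e fx → act-free⁺ s e fx λ z′ eq′ → x≢e ,
          λ { refl → proper e x (proj₂ (proj₂ (partner-free s e eq′))) (sym cx) }
      ; opposite = λ x _ → act-free⁻ s e }

    -- For a decider `w` the candidates in the two states are nested, in a direction given by its
    -- colour. A violation would make `w` take, in one state only, some x that is free in both; its
    -- choice in the other state is then free in both too, and `partner-agree` identifies them. The
    -- one candidate that escapes the nesting is `e`; it is excluded, as is an effective decision by
    -- `e` itself, because `e` stays free in the waiting run.
    ahead-act : ∀ {e s s′} w → Ahead e s s′ → Free (act s w) e → Ahead e (act s w) (act s′ w)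
    ahead-act {e} {s} {s′} w ah fe = record { same = same′ ; opposite = opposite′ }
      where
      same′ : ∀ x → colour x ≡ colour e → x ≢ e → Free (act s w) x → Free (act s′ w) x
      same′ x cx x≢e fx = act-free⁺ s′ w (same ah x cx x≢e fsx) λ z′ eq′ → x≢w z′ eq′ , x≢z′ z′ eq′
        where
        fsx = act-free⁻ s w fx
        x≢w : ∀ z′ → partner s′ w ≡ just z′ → x ≢ w
        x≢w z′ eq′ refl with partner-free s′ x eq′
        ... | _ , fz′ , adj with partner-exists s x fsx adj (opposite ah z′ (colour-flip′ adj cx) fz′)
        ... | z , eq = proj₁ (act-free-≢ s x fx eq) refl
        x≢z′ : ∀ z′ → partner s′ w ≡ just z′ → x ≢ z′
        x≢z′ z′ eq′ refl with partner-free s′ w eq′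
        ... | fw′ , fz′ , adj with opposite ah w (colour-flip′ (adj-sym adj) cx) fw′
        ... | fw with partner-exists s w fw adj fsx
        ... | z , eq with partner-free s w eq
        ... | _ , fz , adjz = proj₂ (act-free-≢ s w fx eq)
          (sym (partner-agree s s′ w eq eq′ (same ah z (colour-flip adjz (colour-flip′ (adj-sym adj) cx)) z≢e fz) fsx))
          where
          z≢e : z ≢ e
          z≢e refl = proj₂ (act-free-≢ s w fe eq) refl
      opposite′ : ∀ x → colour x ≢ colour e → Free (act s′ w) x → Free (act s w) x
      opposite′ x cx fx = act-free⁺ s w (opposite ah x cx fsx) λ z eq → x≢w z eq , x≢z z eq
        where
        fsx = act-free⁻ s′ w fx
        x≢w : ∀ z → partner s w ≡ just z → x ≢ w
        x≢w z eq refl with partner-free s x eq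
        ... | _ , fz , adj with partner-exists s′ x fsx adj (same ah z (colour-flip adj cx) (λ { refl → proj₂ (act-free-≢ s x fe eq) refl }) fz)
        ... | z′ , eq′ = proj₁ (act-free-≢ s′ x fx eq′) refl
        x≢z : ∀ z → partner s w ≡ just z → x ≢ z
        x≢z z eq refl with partner-free s w eq
        ... | fw , fz , adj with colour-flip (adj-sym adj) cx
        ... | cw with partner-exists s′ w (same ah w cw (λ { refl → proj₁ (act-free-≢ s w fe eq) refl }) fw) adj fsx
        ... | z′ , eq′ with partner-free s′ w eq′
        ... | _ , fz′ , adjz′ = proj₂ (act-free-≢ s′ w fx eq′)
          (partner-agree s s′ w eq eq′ fsx (opposite ah z′ (colour-flip′ adjz′ cw) fz′))

    ahead-exec : ∀ {e s s′} l → Ahead e s s′ → Free (exec s l) e → Ahead e (exec s l) (exec s′ l)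
    ahead-exec [] ah fe = ah
    ahead-exec (nothing ∷ l) ah fe = ahead-exec l ah fe
    ahead-exec {s = s} (just w ∷ l) ah fe = ahead-exec l (ahead-act w ah (exec-free⁻ (act s w) l fe)) fe
    colour-other : ∀ {a b} → Adj G a b ≡ true → colour b ≢ colour a
    colour-other {a} {b} adj e = proper a b adj (sym e)

  -- Ranks as positions among the dummies

  holes : List Item → ℕ
  holes [] = 0
  holes (nothing ∷ l) = suc (holes l)
  holes (just _ ∷ l) = holes l

  before : ℕ → List Item → List Item
  before zero l = []
  before (suc k) [] = []
  before (suc k) (nothing ∷ l) = nothing ∷ before k l
  before (suc k) (just w ∷ l) = just w ∷ before (suc k) l

  from : ℕ → List Item → List Item
  from zero l = l
  from (suc k) [] = []
  from (suc k) (nothing ∷ l) = from k l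
  from (suc k) (just w ∷ l) = from (suc k) l

  -- The vertex goes directly behind the k-th dummy, hence ahead of all other vertices of its rank.
  -- The state in which it decides is then determined by the rank alone.
  insertAt : ℕ → Fin n → List Item → List Item
  insertAt k a l = before k l ++ just a ∷ from k l

  before-++-from : ∀ k l → before k l ++ from k l ≡ l
  before-++-from zero l = refl
  before-++-from (suc k) [] = refl
  before-++-from (suc k) (nothing ∷ l) = cong (nothing ∷_) (before-++-from k l)
  before-++-from (suc k) (just w ∷ l) = cong (just w ∷_) (before-++-from (suc k) l)

  before-+ : ∀ i d l → before (i + d) l ≡ before i l ++ before d (from i l)
  before-+ zero d l = refl
  before-+ (suc i) zero [] = refl
  before-+ (suc i) (suc d) [] = refl
  before-+ (suc i) d (nothing ∷ l) = cong (nothing ∷_) (before-+ i d l)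
  before-+ (suc i) d (just w ∷ l) = cong (just w ∷_) (before-+ (suc i) d l)

  holes-before : ∀ i l → i ≤ holes l → holes (before i l) ≡ i
  holes-before zero l _ = refl
  holes-before (suc i) (nothing ∷ l) h = cong suc (holes-before i l (≤-pred h))
  holes-before (suc i) (just w ∷ l) h = holes-before (suc i) l h

  holes-from : ∀ i l → i ≤ holes l → i + holes (from i l) ≡ holes l
  holes-from zero l _ = refl
  holes-from (suc i) (nothing ∷ l) h = cong suc (holes-from i l (≤-pred h))
  holes-from (suc i) (just w ∷ l) h = holes-from (suc i) l h

  before-within : ∀ i Q r → i ≤ holes Q → before i (Q ++ r) ≡ before i Q
  before-within zero Q r _ = refl
  before-within (suc i) (nothing ∷ Q) r h = cong (nothing ∷_) (before-within i Q r (≤-pred h))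
  before-within (suc i) (just w ∷ Q) r h = cong (just w ∷_) (before-within (suc i) Q r h)

  from-within : ∀ i Q r → i ≤ holes Q → from i (Q ++ r) ≡ from i Q ++ r
  from-within zero Q r _ = refl
  from-within (suc i) (nothing ∷ Q) r h = from-within i Q r (≤-pred h)
  from-within (suc i) (just w ∷ Q) r h = from-within (suc i) Q r h

  before-beyond : ∀ Q d r → before (holes Q + suc d) (Q ++ r) ≡ Q ++ before (suc d) r
  before-beyond [] d r = refl
  before-beyond (nothing ∷ Q) d r = cong (nothing ∷_) (before-beyond Q d r)
  before-beyond (just w ∷ Q) d r rewrite +-suc (holes Q) d =
    cong (just w ∷_) (trans (cong (λ m → before m (Q ++ r)) (sym (+-suc (holes Q) d))) (before-beyond Q d r))

  insertAt-skip : ∀ i d b l r → i ≤ holes l → insertAt (i + d) b (before i l ++ r) ≡ before i l ++ insertAt d b r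
  insertAt-skip zero d b l r _ = refl
  insertAt-skip (suc i) d b (nothing ∷ l) r h = cong (nothing ∷_) (insertAt-skip i d b l r (≤-pred h))
  insertAt-skip (suc i) d b (just w ∷ l) r h = cong (just w ∷_) (insertAt-skip (suc i) d b l r h)

  insertPair : List Item → ℕ → ℕ → Fin n → Fin n → List Item
  insertPair l i d a b = before i l ++ just a ∷ insertAt d b (from i l)

  insert-outer-first : ∀ i d a b l → i ≤ holes l → insertAt i a (insertAt (i + d) b l) ≡ insertPair l i d a b
  insert-outer-first i d a b l h = trans
    (cong (insertAt i a) (trans (cong (insertAt (i + d) b) (sym (before-++-from i l))) (insertAt-skip i d b l (from i l) h)))
    (trans (cong (λ k → insertAt k a (before i l ++ insertAt d b (from i l))) (sym (+-identityʳ i)))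
      (insertAt-skip i 0 a l (insertAt d b (from i l)) h))

  insert-outer-second : ∀ i d a b l → i ≤ holes l → insertAt (i + suc d) b (insertAt i a l) ≡ insertPair l i (suc d) a b
  insert-outer-second i d a b l h = insertAt-skip i (suc d) b l (just a ∷ from i l) h

  Avoids : Fin n → List Item → Set
  Avoids v = All (_≢ just v)

  unmatched : State
  unmatched _ = nothing

  -- What the endpoints of an edge earn in a run

  -- The two hypotheses make premature matching harmless. A vertex that has not decided can only
  -- have been matched passively, which pays at least any active share and at least any passive
  -- share of a later rank. Hence each argument below may suppose that the vertex is still free when
  -- needed.
  module Gain (f p : ℕ → ℕ) (f≤p : ∀ i j → f i ≤ p j) (p-antitone : ∀ {i j} → i ≤ j → p j ≤ p i) where

    share : ℕ → Fin n → Fin n → Fin n → ℕ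
    share k a b v = (if does (v ≟ a) then f k else 0) + (if does (v ≟ b) then p k else 0)

    earn : Fin n → ℕ → State → Fin n → ℕ
    earn v k s w = maybe′ (λ z → share k w z v) 0 (partner s w)

    gain : Fin n → ℕ → State → List Item → ℕ
    gain v k s [] = 0
    gain v k s (nothing ∷ l) = gain v (suc k) s l
    gain v k s (just w ∷ l) = earn v k s w + gain v k (act s w) l

    gain-++ : ∀ v k s xs ys → gain v k s (xs ++ ys) ≡ gain v k s xs + gain v (k + holes xs) (exec s xs) ys
    gain-++ v k s [] ys = cong (λ m → gain v m s ys) (sym (+-identityʳ k))
    gain-++ v k s (nothing ∷ xs) ys = trans (gain-++ v (suc k) s xs ys)
      (cong (λ m → gain v (suc k) s xs + gain v m (exec s xs) ys) (sym (+-suc k (holes xs))))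
    gain-++ v k s (just w ∷ xs) ys = trans (cong (earn v k s w +_) (gain-++ v k (act s w) xs ys))
      (sym (+-assoc (earn v k s w) _ _))

    gain-prefix : ∀ v k s xs ys → gain v k s xs ≤ gain v k s (xs ++ ys)
    gain-prefix v k s xs ys = ≤-trans (m≤m+n _ _) (≤-reflexive (sym (gain-++ v k s xs ys)))

    gain-suffix : ∀ v k s xs ys → gain v (k + holes xs) (exec s xs) ys ≤ gain v k s (xs ++ ys)
    gain-suffix v k s xs ys = ≤-trans (m≤n+m _ (gain v k s xs)) (≤-reflexive (sym (gain-++ v k s xs ys)))

    earn-active : ∀ k s w {z} → partner s w ≡ just z → f k ≤ earn w k s w
    earn-active k s w eq rewrite eq with w ≟ w
    ... | yes _ = m≤m+n (f k) _
    ... | no w≢w = ⊥-elim (w≢w refl)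

    earn-passive : ∀ k s w {v} → partner s w ≡ just v → p k ≤ earn v k s w
    earn-passive k s w {v} eq rewrite eq with v ≟ v
    ... | yes _ = m≤n+m (p k) _
    ... | no v≢v = ⊥-elim (v≢v refl)

    gain-matched : ∀ v k s l → Avoids v l → Free s v → ¬ Free (exec s l) v → p (k + holes l) ≤ gain v k s l
    gain-matched v k s [] _ fv ¬fv = ⊥-elim (¬fv fv)
    gain-matched v k s (nothing ∷ l) (_ ∷ av) fv ¬fv =
      subst (λ m → p m ≤ gain v (suc k) s l) (sym (+-suc k (holes l))) (gain-matched v (suc k) s l av fv ¬fv)
    gain-matched v k s (just w ∷ l) (w≢v ∷ av) fv ¬fv with free? (act s w) v
    ... | yes fv′ = ≤-trans (gain-matched v k (act s w) l av fv′ ¬fv) (m≤n+m _ (earn v k s w))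
    ... | no ¬fv′ with act-matched s w fv ¬fv′
    ...   | z , eq , inj₁ refl = ⊥-elim (w≢v refl)
    ...   | z , eq , inj₂ refl = ≤-trans (p-antitone (m≤m+n k (holes l)))
            (≤-trans (earn-passive k s w eq) (m≤m+n (earn v k s w) _))

    gain-second : ∀ b k s xs ys → Avoids b xs → Free s b →
      (Free (exec s xs) b → ∃[ z ] partner (exec s xs) b ≡ just z) →
      f (k + holes xs) ≤ gain b k s (xs ++ just b ∷ ys)
    gain-second b k s xs ys av fb next with free? (exec s xs) b
    ... | yes fb′ = ≤-trans (≤-trans (earn-active (k + holes xs) (exec s xs) b (proj₂ (next fb′))) (m≤m+n _ _))
            (gain-suffix b k s xs (just b ∷ ys))
    ... | no ¬fb′ = ≤-trans (f≤p _ (k + holes xs)) (≤-trans (gain-matched b k s xs av fb ¬fb′) (gain-prefix b k s xs _))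

    gain-hit : ∀ v k s Q w r → partner (exec s Q) w ≡ just v → p (k + holes Q) ≤ gain v k s (Q ++ just w ∷ r)
    gain-hit v k s Q w r eq = ≤-trans (earn-passive (k + holes Q) (exec s Q) w eq)
      (≤-trans (m≤m+n _ _) (gain-suffix v k s Q (just w ∷ r)))

    late-gain : ∀ Q w r {v} i d a b → partner (exec unmatched Q) w ≡ just v → holes Q < i →
      p (holes Q) ≤ gain v 0 unmatched (insertPair (Q ++ just w ∷ r) i d a b)
    late-gain Q w r {v} i d a b eq t<i = ≤-trans (gain-hit v 0 unmatched Q w (before (suc e) r) eq)
      (≤-trans (≤-reflexive (cong (gain v 0 unmatched) (sym (trans (cong (λ k → before k (Q ++ just w ∷ r)) i≡) (before-beyond Q e _)))))
        (gain-prefix v 0 unmatched (before i (Q ++ just w ∷ r)) _))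
      where
      e = i ∸ suc (holes Q)
      i≡ : i ≡ holes Q + suc e
      i≡ = trans (sym (m+[n∸m]≡n t<i)) (sym (+-suc (holes Q) e))

    module Base (l : List Item) (a b : Fin n) (adj : Adj G a b ≡ true) where

      base : ℕ → State
      base i = exec unmatched (before i l)

      base-+ : ∀ i d → base (i + d) ≡ exec (base i) (before d (from i l))
      base-+ i d = trans (cong (exec unmatched) (before-+ i d l)) (exec-++ unmatched (before i l) _)

      base-free : ∀ {i j} v → i ≤ j → Free (base j) v → Free (base i) v
      base-free {i} {j} v i≤j fv = exec-free⁻ (base i) (before (j ∸ i) (from i l))
        (subst (λ s → Free s v) (trans (cong base (sym (m+[n∸m]≡n i≤j))) (base-+ i (j ∸ i))) fv)

      gain-pair : ∀ v i d → i ≤ holes l →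
        gain v i (base i) (just a ∷ insertAt d b (from i l)) ≤ gain v 0 unmatched (insertPair l i d a b)
      gain-pair v i d h = subst (λ m → gain v m (base i) (just a ∷ insertAt d b (from i l)) ≤ gain v 0 unmatched (insertPair l i d a b))
        (holes-before i l h) (gain-suffix v 0 unmatched (before i l) _)

      first-gain : ∀ i d → i ≤ holes l → Free (base i) a → Free (base i) b → f i ≤ gain a 0 unmatched (insertPair l i d a b)
      first-gain i d h fa fb = ≤-trans (earn-active i (base i) a (proj₂ (partner-exists (base i) a fa adj fb)))
        (≤-trans (m≤m+n _ _) (gain-pair a i d h))

      passive-gain : ∀ i d → i ≤ holes l → partner (base i) a ≡ just b → p i ≤ gain b 0 unmatched (insertPair l i d a b)
      passive-gain i d h eq = ≤-trans (earn-passive i (base i) a eq) (≤-trans (m≤m+n _ _) (gain-pair b i d h))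

      gain-after : ∀ i d {x} → i ≤ holes l → x ≤ gain b i (act (base i) a) (insertAt d b (from i l)) →
        x ≤ gain b 0 unmatched (insertPair l i d a b)
      gain-after i d h x≤ = ≤-trans x≤ (≤-trans (m≤n+m _ (earn b i (base i) a)) (gain-pair b i d h))

      module _ (colour : Fin n → Bool) (proper : ∀ u v → Adj G u v ≡ true → colour u ≢ colour v) (b∉l : Avoids b l) where
        open Coupling colour proper

        avoids-before : ∀ k m → Avoids b m → Avoids b (before k m)
        avoids-before k m av = All.++⁻ˡ (before k m) (subst (Avoids b) (sym (before-++-from k m)) av)

        avoids-from : ∀ k m → Avoids b m → Avoids b (from k m)
        avoids-from k m av = All.++⁻ʳ (before k m) (subst (Avoids b) (sym (before-++-from k m)) av)

        -- The vertex z has the colour of a, differs from a, and is free in the base run, where a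
        -- waits; by `Ahead` it is free here too, and b, if still free, finds a neighbour. If a has
        -- taken b itself, b has a passive share instead.
        second-gain : ∀ i d {z} → i + suc d ≤ holes l → Free (base (i + suc d)) a →
          partner (base (i + suc d)) b ≡ just z → z ≢ a → f (i + suc d) ≤ gain b 0 unmatched (insertPair l i (suc d) a b)
        second-gain i d {z} h fa eq z≢a with partner-free _ b eq
        ... | fb , fz , adjz with partner-exists (base i) a (base-free a (m≤m+n i (suc d)) fa) adj (base-free b (m≤m+n i (suc d)) fb)
        ... | r , eqr with b ≟ r
        ... | yes refl = ≤-trans (f≤p (i + suc d) i) (passive-gain i (suc d) (≤-trans (m≤m+n i (suc d)) h) eqr)
        ... | no b≢r = gain-after i (suc d) i≤ (subst (λ k → f (i + k) ≤ gain b i s′ (insertAt (suc d) b m))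
              (holes-before (suc d) m suc-d≤)
              (gain-second b i s′ (before (suc d) m) (from (suc d) m) (avoids-before (suc d) m (avoids-from i l b∉l)) fb′
                (λ fb″ → partner-exists (exec s′ (before (suc d) m)) b fb″ adjz (same ah z (colour-flip adjz (colour-other adj)) z≢a
                  (subst (λ s → Free s z) (base-+ i (suc d)) fz)))))
          where
          m = from i l
          s′ = act (base i) a
          i≤ = ≤-trans (m≤m+n i (suc d)) h
          suc-d≤ : suc d ≤ holes m
          suc-d≤ = +-cancelˡ-≤ i _ _ (≤-trans h (≤-reflexive (sym (holes-from i l i≤))))
          fb′ : Free s′ b
          fb′ = act-free⁺ (base i) a (base-free b (m≤m+n i (suc d)) fb)
            λ z eq → (λ { refl → adj-irrefl adj refl }) , λ { refl → b≢r (just-injective (trans (sym eq) eqr)) }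
          ah : Ahead a (exec (base i) (before (suc d) m)) (exec s′ (before (suc d) m))
          ah = ahead-exec (before (suc d) m) (ahead-start (base i) a eqr) (subst (λ s → Free s a) (base-+ i (suc d)) fa)

      -- In the base run `w` chooses b while a is free. Being a neighbour of b, `w` has the colour
      -- of a, so `Ahead` also keeps `w` free until its turn in the run in which a has decided and
      -- taken someone other than b.
      module Awaiting (colour : Fin n → Bool) (proper : ∀ u v → Adj G u v ≡ true → colour u ≢ colour v)
          (Q R : List Item) (w : Fin n) (l≡ : l ≡ Q ++ just w ∷ R) (a∉l : Avoids a l) (b∉l : Avoids b l)
          (fa : Free (exec unmatched Q) a) (hit : partner (exec unmatched Q) w ≡ just b) where
        open Coupling colour proper

        private
          w≢a : w ≢ a
          w≢a refl = All.head (All.++⁻ʳ Q (subst (Avoids a) l≡ a∉l)) refl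

          b∉Q : Avoids b Q
          b∉Q = All.++⁻ˡ Q (subst (Avoids b) l≡ b∉l)

          fw : Free (exec unmatched Q) w
          fw = proj₁ (partner-free (exec unmatched Q) w hit)

          fb : Free (exec unmatched Q) b
          fb = proj₁ (proj₂ (partner-free (exec unmatched Q) w hit))

          adj-wb : Adj G w b ≡ true
          adj-wb = proj₂ (proj₂ (partner-free (exec unmatched Q) w hit))

          colour-w : colour w ≡ colour a
          colour-w = colour-flip (adj-sym adj-wb) (colour-other adj)

        module _ (i : ℕ) (i≤t : i ≤ holes Q) {z} (eq : partner (base i) a ≡ just z) (z≢b : z ≢ b) where

          private
            Q′ = from i Q
            s′ = act (base i) a

            base≡ : base i ≡ exec unmatched (before i Q)
            base≡ = cong (exec unmatched) (trans (cong (before i) l≡) (before-within i Q _ i≤t))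

            from≡ : from i l ≡ Q′ ++ just w ∷ R
            from≡ = trans (cong (from i) l≡) (from-within i Q _ i≤t)

            exec-Q′ : exec (base i) Q′ ≡ exec unmatched Q
            exec-Q′ = trans (cong (λ s → exec s Q′) base≡)
              (trans (sym (exec-++ unmatched (before i Q) Q′)) (cong (exec unmatched) (before-++-from i Q)))

            b∉Q′ : Avoids b Q′
            b∉Q′ = All.++⁻ʳ (before i Q) (subst (Avoids b) (sym (before-++-from i Q)) b∉Q)

            i≤D : i ≤ holes l
            i≤D = ≤-trans i≤t (subst (holes Q ≤_) (cong holes (sym l≡)) (holes-≤ Q))
              where
              holes-≤ : ∀ X → holes X ≤ holes (X ++ just w ∷ R)
              holes-≤ [] = z≤n
              holes-≤ (nothing ∷ X) = s≤s (holes-≤ X)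
              holes-≤ (just _ ∷ X) = holes-≤ X

            fb′ : Free s′ b
            fb′ = act-free⁺ (base i) a (exec-free⁻ (base i) Q′ (subst (λ s → Free s b) (sym exec-Q′) fb))
              λ z′ eq′ → (λ { refl → adj-irrefl adj refl }) , λ { refl → z≢b (just-injective (trans (sym eq) eq′)) }

            ahead-within : ∀ X Y → Q′ ≡ X ++ Y → Ahead a (exec (base i) X) (exec s′ X)
            ahead-within X Y e = ahead-exec X (ahead-start (base i) a eq) (exec-free⁻ (exec (base i) X) Y
              (subst (λ s → Free s a) (sym (trans (sym (exec-++ (base i) X Y)) (trans (cong (exec (base i)) (sym e)) exec-Q′))) fa))

          -- At this rank `w` has not yet been matched in the base run, hence not here either, and b
          -- has at least `w` to choose.
          awaiting-early : ∀ d → i + suc d ≤ holes Q → f (i + suc d) ≤ gain b 0 unmatched (insertPair l i (suc d) a b)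
          awaiting-early d h = gain-after i (suc d) i≤D
            (subst₂ (λ k m → f (i + k) ≤ gain b i s′ (m ++ just b ∷ from (suc d) (from i l)))
              (holes-before (suc d) Q′ suc-d≤)
              (sym (trans (cong (before (suc d)) from≡) (before-within (suc d) Q′ _ suc-d≤)))
              (gain-second b i s′ X _ (All.++⁻ˡ X (subst (Avoids b) (sym (before-++-from (suc d) Q′)) b∉Q′)) fb′
                λ fb″ → partner-exists (exec s′ X) b fb″ (adj-sym adj-wb) (same (ahead-within X Y Q′≡) w colour-w w≢a fw-X)))
            where
            X = before (suc d) Q′
            Y = from (suc d) Q′
            Q′≡ : Q′ ≡ X ++ Y
            Q′≡ = sym (before-++-from (suc d) Q′)
            suc-d≤ : suc d ≤ holes Q′
            suc-d≤ = +-cancelˡ-≤ i _ _ (≤-trans h (≤-reflexive (sym (holes-from i Q i≤t))))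
            fw-X : Free (exec (base i) X) w
            fw-X = exec-free⁻ (exec (base i) X) Y
              (subst (λ s → Free s w) (sym (trans (sym (exec-++ (base i) X Y)) (trans (cong (exec (base i)) (sym Q′≡)) exec-Q′))) fw)

          -- If b is still free at the turn of `w`, the choice of `w` here is free in the base run
          -- by `opposite`, while its choice there, b, is free here; so `w` takes b in both.
          awaiting-late : ∀ d → holes Q < i + suc d → p (holes Q) ≤ gain b 0 unmatched (insertPair l i (suc d) a b)
          awaiting-late d h = gain-after i (suc d) i≤D
            (subst₂ (λ k m → p k ≤ gain b i s′ (m ++ just b ∷ from (suc d) (from i l)))
              (holes-from i Q i≤t) (sym before≡) reached)
            where
            e = suc d ∸ suc (holes Q′)
            suc-d≡ : suc d ≡ holes Q′ + suc e
            suc-d≡ = trans (sym (m+[n∸m]≡n (+-cancelˡ-< i _ _ (subst (_< i + suc d) (sym (holes-from i Q i≤t)) h)))) (sym (+-suc (holes Q′) e))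
            before≡ : before (suc d) (from i l) ≡ Q′ ++ just w ∷ before (suc e) R
            before≡ = trans (cong₂ before suc-d≡ from≡) (before-beyond Q′ e _)
            ah : Ahead a (exec unmatched Q) (exec s′ Q′)
            ah = subst (λ s → Ahead a s (exec s′ Q′)) exec-Q′ (ahead-within Q′ [] (sym (List.++-identityʳ Q′)))
            reached : p (i + holes Q′) ≤ gain b i s′ ((Q′ ++ just w ∷ before (suc e) R) ++ just b ∷ from (suc d) (from i l))
            reached with free? (exec s′ Q′) b
            ... | no ¬fb = ≤-trans (gain-matched b i s′ Q′ b∉Q′ fb′ ¬fb)
                    (≤-trans (gain-prefix b i s′ Q′ _) (gain-prefix b i s′ (Q′ ++ just w ∷ before (suc e) R) _))
            ... | yes fb″ with partner-exists (exec s′ Q′) w (same ah w colour-w w≢a fw) adj-wb fb″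
            ...   | z′ , eq′ with partner-agree (exec unmatched Q) (exec s′ Q′) w hit eq′ fb″
                        (opposite ah z′ (colour-flip′ (proj₂ (proj₂ (partner-free (exec s′ Q′) w eq′))) colour-w) (proj₁ (proj₂ (partner-free (exec s′ Q′) w eq′))))
            ...     | refl = ≤-trans (gain-hit b i s′ Q′ w _ eq′) (gain-prefix b i s′ (Q′ ++ just w ∷ before (suc e) R) _)

-- Sums over all permutations, with and without dummies

sumOver : ∀ {A : Set} → (A → ℕ) → List A → ℕ
sumOver F xs = sum (map F xs)

sumOver-++ : ∀ {A : Set} (F : A → ℕ) xs ys → sumOver F (xs ++ ys) ≡ sumOver F xs + sumOver F ys
sumOver-++ F xs ys = trans (cong sum (List.map-++ F xs ys)) (sum-++ (map F xs) (map F ys))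

sumOver-map : ∀ {A B : Set} (F : B → ℕ) (g : A → B) xs → sumOver F (map g xs) ≡ sumOver (F ∘ g) xs
sumOver-map F g xs = cong sum (sym (List.map-∘ xs))

sumOver-concatMap : ∀ {A B : Set} (F : B → ℕ) (g : A → List B) xs → sumOver F (concatMap g xs) ≡ sumOver (sumOver F ∘ g) xs
sumOver-concatMap F g [] = refl
sumOver-concatMap F g (x ∷ xs) = trans (sumOver-++ F (g x) (concatMap g xs)) (cong (sumOver F (g x) +_) (sumOver-concatMap F g xs))

sumOver-cong : ∀ {A : Set} {F H : A → ℕ} {xs} → All (λ x → F x ≡ H x) xs → sumOver F xs ≡ sumOver H xs
sumOver-cong [] = refl
sumOver-cong (e ∷ es) = cong₂ _+_ e (sumOver-cong es)

sumOver-mono : ∀ {A : Set} {F H : A → ℕ} {xs} → All (λ x → F x ≤ H x) xs → sumOver F xs ≤ sumOver H xs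
sumOver-mono [] = z≤n
sumOver-mono (e ∷ es) = +-mono-≤ e (sumOver-mono es)

sumOver-cong′ : ∀ {A : Set} {F H : A → ℕ} → (∀ x → F x ≡ H x) → ∀ xs → sumOver F xs ≡ sumOver H xs
sumOver-cong′ e xs = sumOver-cong (All.universal e xs)

sumOver-+ : ∀ {A : Set} (F H : A → ℕ) xs → sumOver (λ x → F x + H x) xs ≡ sumOver F xs + sumOver H xs
sumOver-+ F H [] = refl
sumOver-+ F H (x ∷ xs) rewrite sumOver-+ F H xs = interchange (F x) (H x) (sumOver F xs) (sumOver H xs)
  where interchange : ∀ a b c d → (a + b) + (c + d) ≡ (a + c) + (b + d)
        interchange = solve-∀

sumOver-* : ∀ {A : Set} c (F : A → ℕ) xs → sumOver (λ x → c * F x) xs ≡ c * sumOver F xs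
sumOver-* c F [] = sym (*-zeroʳ c)
sumOver-* c F (x ∷ xs) rewrite sumOver-* c F xs = sym (*-distribˡ-+ c (F x) _)

sumOver-const : ∀ {A : Set} c (xs : List A) → sumOver (λ _ → c) xs ≡ length xs * c
sumOver-const c [] = refl
sumOver-const c (x ∷ xs) = cong (c +_) (sumOver-const c xs)

sumOver-swap : ∀ {A B : Set} (F : A → B → ℕ) xs ys →
  sumOver (λ x → sumOver (F x) ys) xs ≡ sumOver (λ y → sumOver (λ x → F x y) xs) ys
sumOver-swap F [] ys = sym (trans (sumOver-const 0 ys) (*-zeroʳ (length ys)))
sumOver-swap F (x ∷ xs) ys = trans (cong (sumOver (F x) ys +_) (sumOver-swap F xs ys)) (sym (sumOver-+ (F x) _ ys))

sum-of-ones : ∀ {A : Set} (xs : List A) → sumOver (λ _ → 1) xs ≡ length xs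
sum-of-ones xs = trans (sumOver-const 1 xs) (*-identityʳ (length xs))

insertSum : ∀ {A : Set} → A → (List A → ℕ) → List A → ℕ
insertSum x F l = sumOver F (insertAll x l)

insertSum-∷ : ∀ {A : Set} (x : A) F z l → insertSum x F (z ∷ l) ≡ F (x ∷ z ∷ l) + insertSum x (F ∘ (z ∷_)) l
insertSum-∷ x F z l = cong (F (x ∷ z ∷ l) +_) (sumOver-map F (z ∷_) (insertAll x l))

-- Both orders of insertion produce the same arrangements with the same multiplicities. This is the
-- adjacent transposition on which `permSum-↭` rests.
insertSum-comm : ∀ {A : Set} (x y : A) F l → insertSum x (insertSum y F) l ≡ insertSum y (insertSum x F) l
insertSum-comm x y F [] = swap-last (F (y ∷ x ∷ [])) (F (x ∷ y ∷ []))
  where swap-last : ∀ a b → a + (b + 0) + 0 ≡ b + (a + 0) + 0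
        swap-last = solve-∀
insertSum-comm x y F (z ∷ l) = begin
    insertSum x (insertSum y F) (z ∷ l)
  ≡⟨ unfold x y ⟩
    F (y ∷ x ∷ z ∷ l) + (F (x ∷ y ∷ z ∷ l) + Y) + (X + XY)
  ≡⟨ cong (λ t → F (y ∷ x ∷ z ∷ l) + (F (x ∷ y ∷ z ∷ l) + Y) + (X + t)) (insertSum-comm x y (F ∘ (z ∷_)) l) ⟩
    F (y ∷ x ∷ z ∷ l) + (F (x ∷ y ∷ z ∷ l) + Y) + (X + YX)
  ≡⟨ shuffle (F (y ∷ x ∷ z ∷ l)) (F (x ∷ y ∷ z ∷ l)) Y X YX ⟩
    F (x ∷ y ∷ z ∷ l) + (F (y ∷ x ∷ z ∷ l) + X) + (Y + YX)
  ≡⟨ sym (unfold y x) ⟩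
    insertSum y (insertSum x F) (z ∷ l) ∎
  where
  open ≡-Reasoning
  X = insertSum x (λ q → F (y ∷ z ∷ q)) l
  Y = insertSum y (λ q → F (x ∷ z ∷ q)) l
  XY = insertSum x (insertSum y (F ∘ (z ∷_))) l
  YX = insertSum y (insertSum x (F ∘ (z ∷_))) l
  shuffle : ∀ a b y x c → a + (b + y) + (x + c) ≡ b + (a + x) + (y + c)
  shuffle = solve-∀
  unfold : ∀ x y → insertSum x (insertSum y F) (z ∷ l) ≡
    F (y ∷ x ∷ z ∷ l) + (F (x ∷ y ∷ z ∷ l) + insertSum y (λ q → F (x ∷ z ∷ q)) l)
      + (insertSum x (λ q → F (y ∷ z ∷ q)) l + insertSum x (insertSum y (F ∘ (z ∷_))) l)
  unfold x y = trans (insertSum-∷ x (insertSum y F) z l) (cong₂ _+_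
    (trans (insertSum-∷ y F x (z ∷ l)) (cong (F (y ∷ x ∷ z ∷ l) +_) (insertSum-∷ y (F ∘ (x ∷_)) z l)))
    (trans (sumOver-cong′ (insertSum-∷ y F z) (insertAll x l)) (sumOver-+ _ _ (insertAll x l))))

permSum : ∀ {A : Set} → (List A → ℕ) → List A → ℕ
permSum F xs = sumOver F (perms xs)

permSum-∷ : ∀ {A : Set} (F : List A → ℕ) x xs → permSum F (x ∷ xs) ≡ permSum (insertSum x F) xs
permSum-∷ F x xs = sumOver-concatMap F (insertAll x) (perms xs)

-- `perms` inserts the head of a list last. Moving u and v to the front therefore turns an average
-- over all orders into insertions of u and v into a fixed order of everything else.
permSum-↭ : ∀ {A : Set} {xs ys : List A} → xs ↭ ys → ∀ F → permSum F xs ≡ permSum F ys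
permSum-↭ Perm.refl F = refl
permSum-↭ {xs = _ ∷ xs} {ys = _ ∷ ys} (prep x p) F = trans (permSum-∷ F x xs) (trans (permSum-↭ p (insertSum x F)) (sym (permSum-∷ F x ys)))
permSum-↭ {xs = x ∷ y ∷ xs} {ys = _ ∷ _ ∷ ys} (Perm.swap x y p) F = begin
    permSum F (x ∷ y ∷ xs)
  ≡⟨ trans (permSum-∷ F x (y ∷ xs)) (permSum-∷ _ y xs) ⟩
    permSum (insertSum y (insertSum x F)) xs
  ≡⟨ sumOver-cong′ (insertSum-comm y x F) (perms xs) ⟩
    permSum (insertSum x (insertSum y F)) xs
  ≡⟨ permSum-↭ p _ ⟩
    permSum (insertSum x (insertSum y F)) ys
  ≡⟨ sym (trans (permSum-∷ F y (x ∷ ys)) (permSum-∷ _ x ys)) ⟩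
    permSum F (y ∷ x ∷ ys) ∎
  where open ≡-Reasoning
permSum-↭ (Perm.trans p q) F = trans (permSum-↭ p F) (permSum-↭ q F)

insertAll-↭ : ∀ {A : Set} (x : A) l → All (_↭ x ∷ l) (insertAll x l)
insertAll-↭ x [] = Perm.refl ∷ []
insertAll-↭ x (z ∷ l) = Perm.refl ∷ All.map⁺ (All.map (λ p → ↭-trans (prep z p) (Perm.swap z x Perm.refl)) (insertAll-↭ x l))

perms-↭ : ∀ {A : Set} (xs : List A) → All (_↭ xs) (perms xs)
perms-↭ [] = Perm.refl ∷ []
perms-↭ (x ∷ xs) = All.concat⁺ (All.map⁺ (All.map (λ {q} p → All.map (λ r → ↭-trans r (prep x p)) (insertAll-↭ x q)) (perms-↭ xs)))

length-insertAll : ∀ {A : Set} (x : A) l → length (insertAll x l) ≡ suc (length l)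
length-insertAll x [] = refl
length-insertAll x (z ∷ l) = cong suc (trans (List.length-map (z ∷_) (insertAll x l)) (length-insertAll x l))

length-perms-∷ : ∀ {A : Set} (x : A) xs → length (perms (x ∷ xs)) ≡ suc (length xs) * length (perms xs)
length-perms-∷ x xs = begin
    length (perms (x ∷ xs))
  ≡⟨ sym (sum-of-ones (perms (x ∷ xs))) ⟩
    permSum (λ _ → 1) (x ∷ xs)
  ≡⟨ permSum-∷ (λ _ → 1) x xs ⟩
    permSum (insertSum x (λ _ → 1)) xs
  ≡⟨ sumOver-cong (All.map (λ {q} p → trans (sum-of-ones (insertAll x q)) (trans (length-insertAll x q) (cong suc (↭-length p)))) (perms-↭ xs)) ⟩
    sumOver (λ _ → suc (length xs)) (perms xs)
  ≡⟨ trans (sumOver-const _ (perms xs)) (*-comm (length (perms xs)) _) ⟩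
    suc (length xs) * length (perms xs) ∎
  where open ≡-Reasoning

insertAll-map : ∀ {A B : Set} (g : A → B) x l → insertAll (g x) (map g l) ≡ map (map g) (insertAll x l)
insertAll-map g x [] = refl
insertAll-map g x (z ∷ l) = cong ((g x ∷ g z ∷ map g l) ∷_) (trans (cong (map (g z ∷_)) (insertAll-map g x l))
  (trans (sym (List.map-∘ (insertAll x l))) (List.map-∘ (insertAll x l))))

perms-map : ∀ {A B : Set} (g : A → B) xs → perms (map g xs) ≡ map (map g) (perms xs)
perms-map g [] = refl
perms-map g (x ∷ xs) = trans (cong (concatMap (insertAll (g x))) (perms-map g xs)) (go (perms xs))
  where
  go : ∀ ls → concatMap (insertAll (g x)) (map (map g) ls) ≡ map (map g) (concatMap (insertAll x) ls)
  go [] = refl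
  go (l ∷ ls) = trans (cong₂ _++_ (insertAll-map g x l) (go ls)) (sym (List.map-++ (map g) (insertAll x l) _))

catMaybes-just : ∀ {A : Set} (xs : List A) → catMaybes (map just xs) ≡ xs
catMaybes-just [] = refl
catMaybes-just (x ∷ xs) = cong (x ∷_) (catMaybes-just xs)

insertSum-nothing : ∀ {A : Set} (F : List A → ℕ) l → insertSum nothing (F ∘ catMaybes) l ≡ suc (length l) * F (catMaybes l)
insertSum-nothing F [] = refl
insertSum-nothing F (nothing ∷ l) = trans (insertSum-∷ nothing (F ∘ catMaybes) nothing l) (cong (F (catMaybes l) +_) (insertSum-nothing F l))
insertSum-nothing F (just w ∷ l) = trans (insertSum-∷ nothing (F ∘ catMaybes) (just w) l) (cong (F (w ∷ catMaybes l) +_) (insertSum-nothing (F ∘ (w ∷_)) l))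

padded : ∀ {A : Set} → ℕ → List A → List (Maybe A)
padded D xs = replicate D nothing ++ map just xs

-- The number of ways in which a permutation of xs arises from one of padded D xs.
multiplicity : ∀ {A : Set} → ℕ → List A → ℕ
multiplicity zero xs = 1
multiplicity (suc D) xs = suc (length (padded D xs)) * multiplicity D xs

multiplicity-nonZero : ∀ {A : Set} D (xs : List A) → NonZero (multiplicity D xs)
multiplicity-nonZero zero xs = _
multiplicity-nonZero (suc D) xs = m*n≢0 (suc (length (padded D xs))) _ {{_}} {{multiplicity-nonZero D xs}}

-- `perms` enumerates arrangements of positions, so equal dummies are counted as distinct. A dummy
-- thus has the same number of places in every arrangement, and the factor is uniform.
permSum-padded : ∀ {A : Set} (F : List A → ℕ) D xs → permSum (F ∘ catMaybes) (padded D xs) ≡ multiplicity D xs * permSum F xs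
permSum-padded F zero xs = trans (cong (sumOver (F ∘ catMaybes)) (perms-map just xs))
  (trans (sumOver-map (F ∘ catMaybes) (map just) (perms xs))
    (trans (sumOver-cong′ (λ l → cong F (catMaybes-just l)) (perms xs)) (sym (+-identityʳ _))))
permSum-padded F (suc D) xs = begin
    permSum (F ∘ catMaybes) (nothing ∷ padded D xs)
  ≡⟨ permSum-∷ (F ∘ catMaybes) nothing (padded D xs) ⟩
    permSum (insertSum nothing (F ∘ catMaybes)) (padded D xs)
  ≡⟨ sumOver-cong (All.map (λ {q} p → trans (insertSum-nothing F q) (cong (λ k → suc k * F (catMaybes q)) (↭-length p))) (perms-↭ (padded D xs))) ⟩
    sumOver (λ q → suc (length (padded D xs)) * F (catMaybes q)) (perms (padded D xs))
  ≡⟨ sumOver-* (suc (length (padded D xs))) (F ∘ catMaybes) (perms (padded D xs)) ⟩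
    suc (length (padded D xs)) * permSum (F ∘ catMaybes) (padded D xs)
  ≡⟨ cong (suc (length (padded D xs)) *_) (permSum-padded F D xs) ⟩
    suc (length (padded D xs)) * (multiplicity D xs * permSum F xs)
  ≡⟨ sym (*-assoc (suc (length (padded D xs))) (multiplicity D xs) (permSum F xs)) ⟩
    multiplicity (suc D) xs * permSum F xs ∎
  where open ≡-Reasoning

extract : ∀ {A : Set} {a : A} {xs} → Unique xs → a ∈ xs → ∃[ ys ] xs ↭ a ∷ ys × All (_≢ a) ys × Unique ys
extract (a≢ ∷ uniq) (here refl) = _ , Perm.refl , All.map (λ ne e → ne (sym e)) a≢ , uniq
extract {a = a} {x ∷ xs} (x≢ ∷ uniq) (there a∈xs) with extract uniq a∈xs
... | ys , p , ≢a , uniq′ with All-resp-↭ p x≢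
... | x≢a ∷ x≢ys = x ∷ ys , ↭-trans (prep x p) (Perm.swap x a Perm.refl) , x≢a ∷ ≢a , x≢ys ∷ uniq′

least : ∀ {Q : ℕ → Set} → Decidable Q → ∀ n →
  (∀ i → i < n → ¬ Q i) ⊎ ∃[ m ] m < n × Q m × (∀ i → i < m → ¬ Q i)
least Q? zero = inj₁ λ _ ()
least Q? (suc n) with least Q? n
... | inj₂ (m , m<n , qm , min) = inj₂ (m , m<n⇒m<1+n m<n , qm , min)
... | inj₁ none with Q? n
...   | yes qn = inj₂ (n , n<1+n n , qn , none)
...   | no ¬qn = inj₁ λ i i<1+n → [ none i , (λ { refl → ¬qn }) ]′ (m≤n⇒m<n∨m≡n (≤-pred i<1+n))

-- The bound for one edge, with the order of all other items fixed

square : ℕ → (ℕ → ℕ → ℕ) → ℕ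
square n g = ∑ n (λ y → ∑ n (λ x → g x y))

triangles≤square : ∀ n g → triangle n g + triangle n (λ i j → g j i) ≤ square n g
triangles≤square zero g = z≤n
triangles≤square (suc n) g = begin
    triangle n g + ∑ n (λ i → g i n) + (triangle n (λ i j → g j i) + ∑ n (g n))
  ≤⟨ m≤m+n _ (g n n) ⟩
    triangle n g + ∑ n (λ i → g i n) + (triangle n (λ i j → g j i) + ∑ n (g n)) + g n n
  ≡⟨ shuffle (triangle n g) _ (triangle n (λ i j → g j i)) _ (g n n) ⟩
    (triangle n g + triangle n (λ i j → g j i)) + ∑ n (g n) + (∑ n (λ i → g i n) + g n n)
  ≤⟨ +-monoˡ-≤ (∑ n (λ i → g i n) + g n n) (+-monoˡ-≤ (∑ n (g n)) (triangles≤square n g)) ⟩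
    square n g + ∑ n (g n) + (∑ n (λ i → g i n) + g n n)
  ≡⟨ cong (_+ (∑ n (λ i → g i n) + g n n)) (sym (∑-+ n _ _)) ⟩
    square (suc n) g ∎
  where
  open ≤-Reasoning
  shuffle : ∀ a b c d e → a + b + (c + d) + e ≡ (a + c) + d + (b + e)
  shuffle = solve-∀

triangle-mono : ∀ n {g h : ℕ → ℕ → ℕ} → (∀ i j → i < j → j < n → g i j ≤ h i j) → triangle n g ≤ triangle n h
triangle-mono n le = ∑-mono n λ j j<n → ∑-mono j λ i i<j → le i j i<j j<n

triangle-+ : ∀ n g h → triangle n (λ i j → g i j + h i j) ≡ triangle n g + triangle n h
triangle-+ n g h = trans (∑-cong n λ j _ → ∑-+ j _ _) (∑-+ n _ _)

<-witness : ∀ {i j} → i < j → ∃[ d ] j ≡ i + suc d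
<-witness {i} i<j with ≤-witness i<j
... | d , refl = d , sym (+-suc i d)

module EdgeBound (K S : ℕ) (F P : ℕ → ℕ) (F≤P : ∀ i j → F i ≤ P j) (F+P≡S : ∀ j → F j + P j ≡ S)
    (P-antitone : ∀ {i j} → i ≤ j → P j ≤ P i) (c : ℕ)
    (hit-scores : ∀ {T} → T < K → c ≤ BlockShares.hitScore K S F P (λ j → F≤P j j) F+P≡S T)
    (climb-conds : ∀ {T} → T < K → K * P T ≤ (K + (K ∸ suc T)) * F T)
    (no-hit-scores : ∀ {Θ} → Θ < K → c ≤ BlockShares.noHitScore K S F P (λ j → F≤P j j) F+P≡S Θ)
    (last-score : c ≤ ∑ K (BlockShares.lowerScore K S F P (λ j → F≤P j j) F+P≡S))
    (B : ℕ) {{_ : NonZero B}}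
    {n : ℕ} (G : SimpleGraph n) (colour : Fin n → Bool) (proper : ∀ u v → Adj G u v ≡ true → colour u ≢ colour v)
    (pref : Fin n → List (Fin n)) (order : ∀ u → IsPrefOrder u (pref u)) where

  open BlockShares K S F P (λ j → F≤P j j) F+P≡S
  open Refined B
  open RDO G pref
  open Process G pref order
  open Gain f p (λ i j → F≤P _ _) (λ i≤j → P-antitone (/-monoˡ-≤ B i≤j)) public

  Hit : State → List Item → Fin n → Fin n → Set
  Hit s l u v = ∃ λ Q → ∃ λ w → ∃ λ R →
    l ≡ Q ++ just w ∷ R × Free (exec s Q) u × Free (exec s Q) v × partner (exec s Q) w ≡ just u

  first-hit : ∀ s l u v → Avoids u l → Avoids v l → Free s u → Free s v →
    (Free (exec s l) u × Free (exec s l) v) ⊎ (Hit s l u v ⊎ Hit s l v u)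
  first-hit s [] u v _ _ fu fv = inj₁ (fu , fv)
  first-hit s (nothing ∷ l) u v (_ ∷ au) (_ ∷ av) fu fv with first-hit s l u v au av fu fv
  ... | inj₁ free = inj₁ free
  ... | inj₂ (inj₁ (Q , w , R , eq , hit)) = inj₂ (inj₁ (nothing ∷ Q , w , R , cong (nothing ∷_) eq , hit))
  ... | inj₂ (inj₂ (Q , w , R , eq , hit)) = inj₂ (inj₂ (nothing ∷ Q , w , R , cong (nothing ∷_) eq , hit))
  first-hit s (just w ∷ l) u v (w≢u ∷ au) (w≢v ∷ av) fu fv with free? (act s w) u | free? (act s w) v
  ... | no ¬fu | _ with act-matched s w fu ¬fu
  ...   | z , _ , inj₁ refl = ⊥-elim (w≢u refl)
  ...   | z , eq , inj₂ refl = inj₂ (inj₁ ([] , w , l , refl , fu , fv , eq))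
  first-hit s (just w ∷ l) u v (w≢u ∷ au) (w≢v ∷ av) fu fv | yes _ | no ¬fv with act-matched s w fv ¬fv
  ...   | z , _ , inj₁ refl = ⊥-elim (w≢v refl)
  ...   | z , eq , inj₂ refl = inj₂ (inj₂ ([] , w , l , refl , fv , fu , eq))
  first-hit s (just w ∷ l) u v (w≢u ∷ au) (w≢v ∷ av) fu fv | yes fu′ | yes fv′
    with first-hit (act s w) l u v au av fu′ fv′
  ... | inj₁ free = inj₁ free
  ... | inj₂ (inj₁ (Q , w′ , R , eq , hit)) = inj₂ (inj₁ (just w ∷ Q , w′ , R , cong (just w ∷_) eq , hit))
  ... | inj₂ (inj₂ (Q , w′ , R , eq , hit)) = inj₂ (inj₂ (just w ∷ Q , w′ , R , cong (just w ∷_) eq , hit))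

  -- There is one rank more than there are dummies, since rank 0 lies before the first of them.
  module Order (l : List Item) (holes-l : suc (holes l) ≡ N) where

    pairGain : Fin n → Fin n → Fin n → ℕ → ℕ → ℕ
    pairGain w a b i j = gain w 0 unmatched (insertPair l i (j ∸ i) a b)

    pairGain-≥ : ∀ {x} w a b i d → x ≤ gain w 0 unmatched (insertPair l i (suc d) a b) → x ≤ pairGain w a b i (i + suc d)
    pairGain-≥ {x} w a b i d = subst (λ k → x ≤ gain w 0 unmatched (insertPair l i k a b)) (sym (m+n∸m≡n i (suc d)))

    ≤holes : ∀ {i} → i < N → i ≤ holes l
    ≤holes i<N = ≤-pred (≤-trans i<N (≤-reflexive (sym holes-l)))

    module Edge (u v : Fin n) (adj : Adj G u v ≡ true) (u∉l : Avoids u l) (v∉l : Avoids v l) where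

      open Gains (pairGain u u v) (pairGain v u v) (pairGain v v u) (pairGain u v u) public

      private
        module UV = Base l u v adj
        module VU = Base l v u (adj-sym adj)
        base : ℕ → State
        base = UV.base

      first-shares : ∀ i j → i < j → j < N → Free (base i) u → Free (base i) v →
        f i ≤ pairGain u u v i j × f i ≤ pairGain v v u i j
      first-shares i j i<j j<N fu fv with <-witness i<j
      ... | d , refl = pairGain-≥ u u v i d (UV.first-gain i (suc d) (≤holes (<-trans i<j j<N)) fu fv)
                     , pairGain-≥ v v u i d (VU.first-gain i (suc d) (≤holes (<-trans i<j j<N)) fv fu)

      passive-share-u : ∀ i j → i < j → j < N → partner (base i) v ≡ just u → p i ≤ pairGain u v u i j
      passive-share-u i j i<j j<N eq with <-witness i<j
      ... | d , refl = pairGain-≥ u v u i d (VU.passive-gain i (suc d) (≤holes (<-trans i<j j<N)) eq)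

      passive-share-v : ∀ i j → i < j → j < N → partner (base i) u ≡ just v → p i ≤ pairGain v u v i j
      passive-share-v i j i<j j<N eq with <-witness i<j
      ... | d , refl = pairGain-≥ v u v i d (UV.passive-gain i (suc d) (≤holes (<-trans i<j j<N)) eq)

      second-share-v : ∀ h i {z} → h < i → i < N → Free (base i) u → partner (base i) v ≡ just z → z ≢ u →
        f i ≤ pairGain v u v h i
      second-share-v h i h<i i<N fu eq z≢u with <-witness h<i
      ... | d , refl = pairGain-≥ v u v h d (UV.second-gain colour proper v∉l h d (≤holes i<N) fu eq z≢u)

      second-share-u : ∀ h i {z} → h < i → i < N → Free (base i) v → partner (base i) u ≡ just z → z ≢ v →
        f i ≤ pairGain u v u h i
      second-share-u h i h<i i<N fv eq z≢v with <-witness h<i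
      ... | d , refl = pairGain-≥ u v u h d (VU.second-gain colour proper u∉l h d (≤holes i<N) fv eq z≢v)

      hit-total : Hit unmatched l u v → B * B * c ≤ 2 * (total + N * (2 * S))
      hit-total (Q , w , R , l≡ , fu , fv , hit) =
        ≤-trans (hit-score hit-scores climb-conds t t<N) (*-monoʳ-≤ 2 (hit-bound t t<N first late second))
        where
        t = holes Q
        -- The roles are exchanged: v is the early decider, and u, matched by `w` in the base run,
        -- is the one that awaits.
        module Await = VU.Awaiting colour proper Q R w l≡ v∉l u∉l fv hit
        t<N : t < N
        t<N = subst (t <_) holes-l (s≤s (subst (λ m → t ≤ holes m) (sym l≡) (holes-≤ Q)))
          where
          holes-≤ : ∀ X → holes X ≤ holes (X ++ just w ∷ R)
          holes-≤ [] = z≤n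
          holes-≤ (nothing ∷ X) = s≤s (holes-≤ X)
          holes-≤ (just _ ∷ X) = holes-≤ X
        early-free : ∀ {i x} → i ≤ t → Free (exec unmatched Q) x → Free (base i) x
        early-free {i} {x} i≤t fx = subst (λ m → Free (exec unmatched m) x)
          (sym (trans (cong (before i) l≡) (before-within i Q _ i≤t)))
          (exec-free⁻ (exec unmatched (before i Q)) (from i Q) (subst (λ s → Free s x)
            (trans (cong (exec unmatched) (sym (before-++-from i Q))) (exec-++ unmatched (before i Q) (from i Q))) fx))
        first : ∀ i j → i < j → j < N → i ≤ t → f i ≤ pairGain u u v i j × f i ≤ pairGain v v u i j
        first i j i<j j<N i≤t = first-shares i j i<j j<N (early-free i≤t fu) (early-free i≤t fv)
        late : ∀ i j → i < j → j < N → t < i → p t ≤ pairGain u u v i j × p t ≤ pairGain u v u i j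
        late i j _ _ t<i = subst (λ m → p t ≤ gain u 0 unmatched (insertPair m i (j ∸ i) u v)) (sym l≡) (late-gain Q w R i (j ∸ i) u v hit t<i)
                         , subst (λ m → p t ≤ gain u 0 unmatched (insertPair m i (j ∸ i) v u)) (sym l≡) (late-gain Q w R i (j ∸ i) v u hit t<i)
        second : ∀ i → i ≤ t →
          (∀ j → i < j → j < N → p i ≤ pairGain u v u i j) ⊎
          ((∀ h → h < i → f i ≤ pairGain v u v h i) ×
           (∀ j → i < j → j ≤ t → f j ≤ pairGain u v u i j) ×
           (∀ j → t < j → j < N → p t ≤ pairGain u v u i j))
        second i i≤t with partner-exists (base i) v (early-free i≤t fv) (adj-sym adj) (early-free i≤t fu)
        ... | z , eq with z ≟ u
        ...   | yes refl = inj₁ λ j i<j j<N → passive-share-u i j i<j j<N eq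
        ...   | no z≢u = inj₂ ((λ h h<i → second-share-v h i h<i (≤-<-trans i≤t t<N) (early-free i≤t fu) eq z≢u) , early , late′)
          where
          early : ∀ j → i < j → j ≤ t → f j ≤ pairGain u v u i j
          early j i<j j≤t with <-witness i<j
          ... | d , refl = pairGain-≥ u v u i d (Await.awaiting-early i i≤t eq z≢u d j≤t)
          late′ : ∀ j → t < j → j < N → p t ≤ pairGain u v u i j
          late′ j t<j _ with <-witness (≤-<-trans i≤t t<j)
          ... | d , refl = pairGain-≥ u v u i d (Await.awaiting-late i i≤t eq z≢u d t<j)

      Mutual : ℕ → Set
      Mutual i = partner (base i) v ≡ just u ⊎ partner (base i) u ≡ just v

      no-hit-total : Free (exec unmatched l) u → Free (exec unmatched l) v →
        ∀ θ → θ ≤ N → (∀ i → i < θ → ¬ Mutual i) → (θ < N → partner (base θ) v ≡ just u) →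
        B * B * c ≤ 2 * (total + N * (2 * S))
      no-hit-total fu fv θ θ≤N not-yet v→u =
        ≤-trans (no-hit-score no-hit-scores last-score θ θ≤N) (*-monoʳ-≤ 2
          (no-hit-bound θ (N ∸ θ) (sym (m+[n∸m]≡n θ≤N))
            (λ i j i<j j<N → first-shares i j i<j j<N (always i fu) (always i fv))
            lower
            (λ i j θ≤i i<j j<N → passive-share-u i j i<j j<N (stays i θ≤i (<-trans i<j j<N)))
            upper))
        where
        always : ∀ i {x} → Free (exec unmatched l) x → Free (base i) x
        always i {x} fx = exec-free⁻ (base i) (from i l) (subst (λ s → Free s x)
          (trans (cong (exec unmatched) (sym (before-++-from i l))) (exec-++ unmatched (before i l) (from i l))) fx)
        u-partner : ∀ i → ∃[ z ] partner (base i) u ≡ just z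
        u-partner i = partner-exists (base i) u (always i fu) adj (always i fv)
        v-partner : ∀ i → ∃[ z ] partner (base i) v ≡ just z
        v-partner i = partner-exists (base i) v (always i fv) (adj-sym adj) (always i fu)
        -- As the base run proceeds, free vertices only disappear and u remains free, so what v
        -- preferred to everything else at θ it still prefers.
        stays : ∀ i → θ ≤ i → i < N → partner (base i) v ≡ just u
        stays i θ≤i i<N with v-partner i
        ... | z , eq with partner-agree (base θ) (base i) v (v→u (≤-<-trans θ≤i i<N)) eq (always i fu)
                            (UV.base-free z θ≤i (proj₁ (proj₂ (partner-free (base i) v eq))))
        ... | refl = eq
        lower : ∀ i h → i < θ → h < i → f i ≤ pairGain u v u h i × f i ≤ pairGain v u v h i
        lower i h i<θ h<i with u-partner i | v-partner i
        ... | z , eq | z′ , eq′ =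
          second-share-u h i h<i (≤-trans i<θ θ≤N) (always i fv) eq (λ { refl → not-yet i i<θ (inj₂ eq) }) ,
          second-share-v h i h<i (≤-trans i<θ θ≤N) (always i fu) eq′ (λ { refl → not-yet i i<θ (inj₁ eq′) })
        upper : ∀ i → θ ≤ i → i < N → (∀ j → i < j → j < N → p i ≤ pairGain v u v i j) ⊎ (∀ h → h < i → f i ≤ pairGain u v u h i)
        upper i θ≤i i<N with u-partner i
        ... | z , eq with z ≟ v
        ...   | yes refl = inj₁ λ j i<j j<N → passive-share-v i j i<j j<N eq
        ...   | no z≢v = inj₂ λ h h<i → second-share-u h i h<i i<N (always i fv) eq z≢v

      total≤square : total ≤ square N (λ x y → gain u 0 unmatched (insertAt x u (insertAt y v l)) + gain v 0 unmatched (insertAt x u (insertAt y v l)))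
      total≤square = begin
          triangle N (pairGain u u v) + triangle N (pairGain v u v) + triangle N (pairGain v v u) + triangle N (pairGain u v u)
        ≡⟨ trans (+-assoc (triangle N (pairGain u u v) + triangle N (pairGain v u v)) _ _)
             (cong₂ _+_ (sym (triangle-+ N _ _)) (trans (+-comm (triangle N (pairGain v v u)) _) (sym (triangle-+ N _ _)))) ⟩
          triangle N (λ i j → pairGain u u v i j + pairGain v u v i j) + triangle N (λ i j → pairGain u v u i j + pairGain v v u i j)
        ≤⟨ +-mono-≤ (triangle-mono N upper-left) (triangle-mono N lower-right) ⟩
          triangle N W + triangle N (λ i j → W j i)
        ≤⟨ triangles≤square N W ⟩
          square N W ∎
        where
        open ≤-Reasoning
        worth : List Item → ℕ
        worth o = gain u 0 unmatched o + gain v 0 unmatched o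
        W : ℕ → ℕ → ℕ
        W x y = worth (insertAt x u (insertAt y v l))
        upper-left : ∀ i j → i < j → j < N → worth (insertPair l i (j ∸ i) u v) ≤ W i j
        upper-left i j i<j j<N = ≤-reflexive (cong worth (sym (trans
          (cong (λ k → insertAt i u (insertAt k v l)) (sym (m+[n∸m]≡n (<⇒≤ i<j))))
          (insert-outer-first i (j ∸ i) u v l (≤holes (<-trans i<j j<N))))))
        lower-right : ∀ i j → i < j → j < N → worth (insertPair l i (j ∸ i) v u) ≤ W j i
        lower-right i j i<j j<N with <-witness i<j
        ... | d , refl = ≤-reflexive (cong worth (sym (trans
          (insert-outer-second i d v u l (≤holes (<-trans i<j j<N)))
          (cong (λ k → insertPair l i k v u) (sym (m+n∸m≡n i (suc d)))))))

    order-bound : ∀ u v → Adj G u v ≡ true → Avoids u l → Avoids v l →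
      B * B * c ≤ 2 * (square N (λ x y → gain u 0 unmatched (insertAt x u (insertAt y v l)) + gain v 0 unmatched (insertAt x u (insertAt y v l))) + N * (2 * S))
    order-bound u v adj u∉l v∉l = ≤-trans bound (*-monoʳ-≤ 2 (+-monoˡ-≤ (N * (2 * S)) UV.total≤square))
      where
      module UV = Edge u v adj u∉l v∉l
      module VU = Edge v u (adj-sym adj) v∉l u∉l
      exchange : B * B * c ≤ 2 * (VU.total + N * (2 * S)) → B * B * c ≤ 2 * (UV.total + N * (2 * S))
      exchange = subst (λ t → B * B * c ≤ 2 * (t + N * (2 * S)))
        (shuffle (triangle N (pairGain v v u)) (triangle N (pairGain u v u)) (triangle N (pairGain u u v)) (triangle N (pairGain v u v)))
        where
        shuffle : ∀ a b c d → a + b + c + d ≡ c + d + a + b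
        shuffle = solve-∀
      mutual? : ∀ i → Dec (UV.Mutual i)
      mutual? i with ≡-dec (partner (Base.base l u v adj i) v) (just u) | ≡-dec (partner (Base.base l u v adj i) u) (just v)
        where ≡-dec = Data.Maybe.Properties.≡-dec _≟_
      ... | yes e | _ = yes (inj₁ e)
      ... | no _ | yes e = yes (inj₂ e)
      ... | no ¬e | no ¬e′ = no [ ¬e , ¬e′ ]′
      bound : B * B * c ≤ 2 * (UV.total + N * (2 * S))
      bound with first-hit unmatched l u v u∉l v∉l refl refl
      ... | inj₂ (inj₁ hit) = UV.hit-total hit
      ... | inj₂ (inj₂ hit) = exchange (VU.hit-total hit)
      ... | inj₁ (fu , fv) with least mutual? N
      ...   | inj₁ none = UV.no-hit-total fu fv N ≤-refl none λ N<N → ⊥-elim (<-irrefl refl N<N)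
      ...   | inj₂ (θ , θ<N , inj₁ v→u , min) = UV.no-hit-total fu fv θ (<⇒≤ θ<N) min λ _ → v→u
      ...   | inj₂ (θ , θ<N , inj₂ u→v , min) = exchange (VU.no-hit-total fv fu θ (<⇒≤ θ<N)
                (λ i i<θ → [ min i i<θ ∘ inj₂ , min i i<θ ∘ inj₁ ]′) λ _ → u→v)

  -- Averaging over all orders and summing over the edges of the matching

  holes-↭ : ∀ {xs ys : List Item} → xs ↭ ys → holes xs ≡ holes ys
  holes-↭ Perm.refl = refl
  holes-↭ (prep nothing p) = cong suc (holes-↭ p)
  holes-↭ (prep (just _) p) = holes-↭ p
  holes-↭ (Perm.swap nothing nothing p) = cong (suc ∘ suc) (holes-↭ p)
  holes-↭ (Perm.swap nothing (just _) p) = cong suc (holes-↭ p)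
  holes-↭ (Perm.swap (just _) nothing p) = cong suc (holes-↭ p)
  holes-↭ (Perm.swap (just _) (just _) p) = holes-↭ p
  holes-↭ (Perm.trans p q) = trans (holes-↭ p) (holes-↭ q)

  holes-padded : ∀ D (vs : List (Fin n)) → holes (padded D vs) ≡ D
  holes-padded zero [] = refl
  holes-padded zero (_ ∷ vs) = holes-padded zero vs
  holes-padded (suc D) vs = cong suc (holes-padded D vs)

  holes-insertAt : ∀ k a l → holes (insertAt k a l) ≡ holes l
  holes-insertAt zero a l = refl
  holes-insertAt (suc k) a [] = refl
  holes-insertAt (suc k) a (nothing ∷ l) = cong suc (holes-insertAt k a l)
  holes-insertAt (suc k) a (just w ∷ l) = holes-insertAt (suc k) a l

  -- Each rank accounts for just one position, directly behind a dummy. The positions behind another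
  -- vertex contribute nonnegative amounts and are dropped; there are few of them compared with the
  -- dummies.
  insertAt-sum : ∀ a (W : List Item → ℕ) l → ∑ (suc (holes l)) (λ x → W (insertAt x a l)) ≤ insertSum (just a) W l
  insertAt-sum a W [] = ≤-reflexive (sym (+-identityʳ _))
  insertAt-sum a W (nothing ∷ l) = begin
      ∑ (suc (suc (holes l))) (λ x → W (insertAt x a (nothing ∷ l)))
    ≡⟨ ∑-first (suc (holes l)) _ ⟩
      W (just a ∷ nothing ∷ l) + ∑ (suc (holes l)) (λ x → W (nothing ∷ insertAt x a l))
    ≤⟨ +-monoʳ-≤ _ (insertAt-sum a (W ∘ (nothing ∷_)) l) ⟩
      W (just a ∷ nothing ∷ l) + insertSum (just a) (W ∘ (nothing ∷_)) l
    ≡⟨ sym (insertSum-∷ (just a) W nothing l) ⟩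
      insertSum (just a) W (nothing ∷ l) ∎
    where open ≤-Reasoning
  insertAt-sum a W (just w ∷ l) = begin
      ∑ (suc (holes l)) (λ x → W (insertAt x a (just w ∷ l)))
    ≡⟨ ∑-first (holes l) _ ⟩
      W (just a ∷ just w ∷ l) + ∑ (holes l) (λ x → W (just w ∷ insertAt (suc x) a l))
    ≤⟨ +-monoʳ-≤ _ (≤-trans (m≤n+m _ (W (just w ∷ just a ∷ l))) (≤-reflexive (sym (∑-first (holes l) _)))) ⟩
      W (just a ∷ just w ∷ l) + ∑ (suc (holes l)) (λ x → W (just w ∷ insertAt x a l))
    ≤⟨ +-monoʳ-≤ _ (insertAt-sum a (W ∘ (just w ∷_)) l) ⟩
      W (just a ∷ just w ∷ l) + insertSum (just a) (W ∘ (just w ∷_)) l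
    ≡⟨ sym (insertSum-∷ (just a) W (just w) l) ⟩
      insertSum (just a) W (just w ∷ l) ∎
    where open ≤-Reasoning

  insertAt-square : ∀ u v (W : List Item → ℕ) l → suc (holes l) ≡ N →
    square N (λ x y → W (insertAt x u (insertAt y v l))) ≤ insertSum (just v) (insertSum (just u) W) l
  insertAt-square u v W l holes-l = ≤-trans
    (∑-mono N λ y _ → subst (λ m → ∑ m (λ x → W (insertAt x u (insertAt y v l))) ≤ insertSum (just u) W (insertAt y v l))
      (trans (cong suc (holes-insertAt y v l)) holes-l) (insertAt-sum u W (insertAt y v l)))
    (subst (λ m → ∑ m (λ y → insertSum (just u) W (insertAt y v l)) ≤ insertSum (just v) (insertSum (just u) W) l)
      holes-l (insertAt-sum v (insertSum (just u) W) l))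

  worth : Fin n → Fin n → List Item → ℕ
  worth u v o = gain u 0 unmatched o + gain v 0 unmatched o

  -- Each endpoint has at most `N + n` positions, whereas only the N ranks are credited. The
  -- hypothesis `budget` absorbs this discrepancy together with the diagonal error `N * (2 * S)`;
  -- the quotient ρ / σ becomes the guaranteed average earnings of an edge.
  module Average (D : ℕ) (D<N : suc D ≡ N) (ρ σ : ℕ)
    (budget : 2 * ρ * ((N + n) * (N + n)) + 2 * (N * (2 * S)) * σ ≤ σ * (B * B * c)) where

    X : List Item
    X = padded D (allFin n)

    edge-average : ∀ u v → Adj G u v ≡ true → ρ * length (perms X) ≤ σ * permSum (worth u v) X
    edge-average u v adj with extract (allFin⁺ n) (∈-allFin u)
    ... | vs , p , vs≢u , uniq with All-resp-↭ {P = λ x → x ≡ u ⊎ x ∈ vs} (↭-sym p) (inj₁ refl ∷ All.tabulate inj₂)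
    ... | cover with All.lookup cover (∈-allFin v)
    ... | inj₁ refl = ⊥-elim (adj-irrefl adj refl)
    ... | inj₂ v∈vs with extract uniq v∈vs
    ... | ws , q , ws≢v , _ with All-resp-↭ q vs≢u
    ... | _ ∷ ws≢u = *-cancelˡ-≤ 2 (+-cancelʳ-≤ (2 * (N * (2 * S)) * σ * Q) _ _ (begin
          2 * (ρ * length (perms X)) + 2 * (N * (2 * S)) * σ * Q
        ≡⟨ cong (λ t → 2 * (ρ * t) + 2 * (N * (2 * S)) * σ * Q) count ⟩
          2 * (ρ * (suc (suc k) * (suc k * Q))) + 2 * (N * (2 * S)) * σ * Q
        ≡⟨ factor ρ (suc (suc k)) (suc k) Q (2 * (N * (2 * S)) * σ) ⟩
          (2 * ρ * (suc (suc k) * suc k) + 2 * (N * (2 * S)) * σ) * Q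
        ≤⟨ *-monoˡ-≤ Q (≤-trans (+-monoˡ-≤ _ (*-monoʳ-≤ (2 * ρ) (*-mono-≤ size (≤-trans (n≤1+n _) size)))) budget) ⟩
          σ * (B * B * c) * Q
        ≤⟨ average ⟩
          2 * (σ * permSum (worth u v) X) + 2 * (N * (2 * S)) * σ * Q ∎))
      where
      open ≤-Reasoning
      Y = padded D ws
      Q = length (perms Y)
      k = length Y
      X↭ : X ↭ just u ∷ just v ∷ Y
      X↭ = ↭-trans (++⁺ˡ (replicate D nothing) (↭-map⁺ just (↭-trans p (prep u q))))
        (↭-trans (shift (just u) (replicate D nothing) _) (prep (just u) (shift (just v) (replicate D nothing) _)))
      count : length (perms X) ≡ suc (suc k) * (suc k * Q)
      count = trans (sym (sum-of-ones (perms X))) (trans (permSum-↭ X↭ (λ _ → 1)) (trans (sum-of-ones (perms (just u ∷ just v ∷ Y)))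
        (trans (length-perms-∷ (just u) (just v ∷ Y)) (cong (suc (suc k) *_) (length-perms-∷ (just v) Y)))))
      size : suc (suc k) ≤ N + n
      size = begin
          length (just u ∷ just v ∷ Y)
        ≡⟨ sym (↭-length X↭) ⟩
          length X
        ≡⟨ trans (List.length-++ (replicate D nothing)) (cong₂ _+_ (List.length-replicate D)
             (trans (List.length-map just (allFin n)) (List.length-tabulate (λ i → i)))) ⟩
          D + n
        ≤⟨ +-monoˡ-≤ n (≤-trans (n≤1+n D) (≤-reflexive D<N)) ⟩
          N + n ∎
      factor : ∀ ρ a b q t → 2 * (ρ * (a * (b * q))) + t * q ≡ (2 * ρ * (a * b) + t) * q
      factor = solve-∀
      avoids : ∀ {x} D vs → All (_≢ x) vs → Avoids x (padded D vs)
      avoids zero _ h = All.map⁺ (All.map (λ ne e → ne (just-injective e)) h)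
      avoids (suc D) vs h = (λ ()) ∷ avoids D vs h
      order-total : ∀ {l} → l ↭ Y → B * B * c ≤ 2 * (insertSum (just v) (insertSum (just u) (worth u v)) l + N * (2 * S))
      order-total {l} l↭ = ≤-trans
        (Order.order-bound l holes-l u v adj (All-resp-↭ (↭-sym l↭) (avoids D ws ws≢u)) (All-resp-↭ (↭-sym l↭) (avoids D ws ws≢v)))
        (*-monoʳ-≤ 2 (+-monoˡ-≤ (N * (2 * S)) (insertAt-square u v (worth u v) l holes-l)))
        where
        holes-l : suc (holes l) ≡ N
        holes-l = trans (cong suc (trans (holes-↭ l↭) (holes-padded D ws))) D<N
      average : σ * (B * B * c) * Q ≤ 2 * (σ * permSum (worth u v) X) + 2 * (N * (2 * S)) * σ * Q
      average = begin
          σ * (B * B * c) * Q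
        ≡⟨ trans (*-assoc σ _ Q) (cong (σ *_) (trans (*-comm (B * B * c) Q) (sym (sumOver-const (B * B * c) (perms Y))))) ⟩
          σ * sumOver (λ _ → B * B * c) (perms Y)
        ≤⟨ *-monoʳ-≤ σ (sumOver-mono (All.map order-total (perms-↭ Y))) ⟩
          σ * sumOver (λ l → 2 * (pairSum l + N * (2 * S))) (perms Y)
        ≡⟨ cong (σ *_) (trans (sumOver-* 2 _ (perms Y)) (cong (2 *_) (trans (sumOver-+ pairSum _ (perms Y))
             (cong₂ _+_ pairs (sumOver-const (N * (2 * S)) (perms Y)))))) ⟩
          σ * (2 * (permSum (worth u v) X + Q * (N * (2 * S))))
        ≡⟨ spread σ (permSum (worth u v) X) Q (N * (2 * S)) ⟩
          2 * (σ * permSum (worth u v) X) + 2 * (N * (2 * S)) * σ * Q ∎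
        where
        pairSum : List Item → ℕ
        pairSum = insertSum (just v) (insertSum (just u) (worth u v))
        pairs : sumOver pairSum (perms Y) ≡ permSum (worth u v) X
        pairs = sym (trans (permSum-↭ X↭ (worth u v)) (trans (permSum-∷ (worth u v) (just u) (just v ∷ Y)) (permSum-∷ _ (just v) Y)))
        spread : ∀ s w q t → s * (2 * (w + q * t)) ≡ 2 * (s * w) + 2 * t * s * q
        spread = solve-∀

    at-most-once : ∀ (a : Fin n) x {es} → Unique es → sumOver (λ e → if does (e ≟ a) then x else 0) es ≤ x
    at-most-once a x [] = z≤n
    at-most-once a x {e ∷ es} (e≢ ∷ uniq) with e ≟ a
    ... | no _ = at-most-once a x uniq
    ... | yes refl = ≤-reflexive (trans (cong (x +_) (trans (sumOver-cong (All.map absent e≢))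
                       (trans (sumOver-const 0 es) (*-zeroʳ (length es))))) (+-identityʳ x))
      where
      absent : ∀ {y} → e ≢ y → (if does (y ≟ e) then x else 0) ≡ 0
      absent {y} e≢y with y ≟ e
      ... | yes y≡e = ⊥-elim (e≢y (sym y≡e))
      ... | no _ = refl

    scored : State → Fin n → ℕ
    scored s w = maybe′ (λ _ → 1) 0 (partner s w)

    score : State → List Item → ℕ
    score s [] = 0
    score s (nothing ∷ l) = score s l
    score s (just w ∷ l) = scored s w + score (act s w) l

    step-act : ∀ s k w → step (s , k) w ≡ (act s w , k + scored s w)
    step-act s k w with s w
    ... | just _ = cong (s ,_) (sym (+-identityʳ k))
    ... | nothing with choose s w (pref w)
    ...   | nothing = cong (s ,_) (sym (+-identityʳ k))
    ...   | just v = cong (assign s w v ,_) (+-comm 1 k)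

    run-score : ∀ s k l → proj₂ (foldl step (s , k) (catMaybes l)) ≡ k + score s l
    run-score s k [] = sym (+-identityʳ k)
    run-score s k (nothing ∷ l) = run-score s k l
    run-score s k (just w ∷ l) rewrite step-act s k w =
      trans (run-score (act s w) (k + scored s w) l) (+-assoc k (scored s w) _)

    earn-total : ∀ k s w {es} → Unique es → sumOver (λ e → earn e k s w) es ≤ S * scored s w
    earn-total k s w {es} uniq with partner s w
    ... | nothing = ≤-trans (≤-reflexive (trans (sumOver-const 0 es) (*-zeroʳ (length es)))) z≤n
    ... | just z = begin
        sumOver (λ e → share k w z e) es
      ≡⟨ sumOver-+ _ _ es ⟩
        _
      ≤⟨ +-mono-≤ (at-most-once w (f k) uniq) (at-most-once z (p k) uniq) ⟩
        f k + p k
      ≡⟨ trans (F+P≡S _) (sym (*-identityʳ S)) ⟩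
        S * 1 ∎
      where open ≤-Reasoning

    gain-total : ∀ k s l {es} → Unique es → sumOver (λ e → gain e k s l) es ≤ S * score s l
    gain-total k s [] {es} uniq = ≤-trans (≤-reflexive (trans (sumOver-const 0 es) (*-zeroʳ (length es)))) z≤n
    gain-total k s (nothing ∷ l) uniq = gain-total (suc k) s l uniq
    gain-total k s (just w ∷ l) {es} uniq = ≤-trans (≤-reflexive (sumOver-+ _ _ es))
      (≤-trans (+-mono-≤ (earn-total k s w uniq) (gain-total k (act s w) l uniq)) (≤-reflexive (sym (*-distribˡ-+ S (scored s w) _))))

    sumOver-endpoints : ∀ (g : Fin n → ℕ) (M : List (Fin n × Fin n)) → sumOver (λ e → g (proj₁ e) + g (proj₂ e)) M ≡ sumOver g (endpoints M)
    sumOver-endpoints g [] = refl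
    sumOver-endpoints g ((u , v) ∷ M) = trans (+-assoc (g u) (g v) _) (cong (λ t → g u + (g v + t)) (sumOver-endpoints g M))

    -- The endpoints of M are pairwise distinct, so one run pays them together at most S for each
    -- edge that it adds. Exchanging the sum over M with the sum over orders then compares the
    -- edgewise averages with the size of the output.
    matching-bound : ∀ M → IsMatching G M → ρ * numOrders * length M ≤ σ * (S * totalSize)
    matching-bound M (edges , uniq) = *-cancelˡ-≤ R {{multiplicity-nonZero D (allFin n)}} (begin
        R * (ρ * numOrders * length M)
      ≡⟨ left R ρ numOrders (length M) ⟩
        length M * (ρ * (R * numOrders))
      ≡⟨ cong (λ t → length M * (ρ * t)) (sym orders) ⟩
        length M * (ρ * length (perms X))
      ≡⟨ sym (sumOver-const _ M) ⟩
        sumOver (λ _ → ρ * length (perms X)) M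
      ≤⟨ sumOver-mono (All.map (λ {e} → edge-average (proj₁ e) (proj₂ e)) edges) ⟩
        sumOver (λ e → σ * permSum (worth (proj₁ e) (proj₂ e)) X) M
      ≡⟨ trans (sumOver-* σ _ M) (cong (σ *_) (sumOver-swap (λ e → worth (proj₁ e) (proj₂ e)) M (perms X))) ⟩
        σ * sumOver (λ o → sumOver (λ e → worth (proj₁ e) (proj₂ e) o) M) (perms X)
      ≤⟨ *-monoʳ-≤ σ (sumOver-mono (All.universal order-worth (perms X))) ⟩
        σ * sumOver (λ o → S * run (catMaybes o)) (perms X)
      ≡⟨ cong (σ *_) (trans (sumOver-* S _ (perms X)) (cong (S *_) (permSum-padded run D (allFin n)))) ⟩
        σ * (S * (R * totalSize))
      ≡⟨ right σ S R totalSize ⟩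
        R * (σ * (S * totalSize)) ∎)
      where
      open ≤-Reasoning
      R = multiplicity D (allFin n)
      left : ∀ r p k m → r * (p * k * m) ≡ m * (p * (r * k))
      left = solve-∀
      right : ∀ a s r t → a * (s * (r * t)) ≡ r * (a * (s * t))
      right = solve-∀
      orders : length (perms X) ≡ R * numOrders
      orders = trans (sym (sum-of-ones (perms X))) (trans (permSum-padded (λ _ → 1) D (allFin n))
        (cong (R *_) (sum-of-ones (perms (allFin n)))))
      order-worth : ∀ o → sumOver (λ e → worth (proj₁ e) (proj₂ e) o) M ≤ S * run (catMaybes o)
      order-worth o = ≤-trans (≤-reflexive (sumOver-endpoints (λ x → gain x 0 unmatched o) M))
        (≤-trans (gain-total 0 unmatched o uniq) (≤-reflexive (cong (S *_) (sym (run-score unmatched 0 o)))))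

-- Choice of the constants and numerical verification

-- With b (n + 1) ranks per block, the margin of c over the ratio r / b absorbs the
-- n vertices that sit among the ranks.
budget : ∀ K S c b r m n → n ≤ m → m ≤ m * m →
  2 * (r * S) * ((K * b + 1) * (K * b + 1)) + 2 * (K * b * (2 * S)) * b ≤ b * (b * b * c) →
  2 * (r * S) * ((K * (b * m) + n) * (K * (b * m) + n)) + 2 * (K * (b * m) * (2 * S)) * b ≤ b * (b * m * (b * m) * c)
budget K S c b r m n n≤m m≤m² margin = begin
    2 * (r * S) * ((K * (b * m) + n) * (K * (b * m) + n)) + 2 * (K * (b * m) * (2 * S)) * b
  ≤⟨ +-mono-≤ (*-monoʳ-≤ (2 * (r * S)) (*-mono-≤ grow grow))
       (≤-trans (≤-reflexive (linear K S m b)) (*-monoʳ-≤ (2 * (K * b * (2 * S)) * b) m≤m²)) ⟩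
    2 * (r * S) * ((K * (b * m) + m) * (K * (b * m) + m)) + 2 * (K * b * (2 * S)) * b * (m * m)
  ≡⟨ left K S m b r ⟩
    (2 * (r * S) * ((K * b + 1) * (K * b + 1)) + 2 * (K * b * (2 * S)) * b) * (m * m)
  ≤⟨ *-monoˡ-≤ (m * m) margin ⟩
    b * (b * b * c) * (m * m)
  ≡⟨ right b m c ⟩
    b * (b * m * (b * m) * c) ∎
  where
  open ≤-Reasoning
  left : ∀ K S m b r → 2 * (r * S) * ((K * (b * m) + m) * (K * (b * m) + m)) + 2 * (K * b * (2 * S)) * b * (m * m)
    ≡ (2 * (r * S) * ((K * b + 1) * (K * b + 1)) + 2 * (K * b * (2 * S)) * b) * (m * m)
  left = solve-∀
  linear : ∀ K S m b → 2 * (K * (b * m) * (2 * S)) * b ≡ 2 * (K * b * (2 * S)) * b * m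
  linear = solve-∀
  right : ∀ b m c → b * (b * b * c) * (m * m) ≡ b * (b * m * (b * m) * c)
  right = solve-∀
  grow : K * (b * m) + n ≤ K * (b * m) + m
  grow = +-monoʳ-≤ (K * (b * m)) n≤m

module Ratio (K S : ℕ) {{_ : NonZero K}} {{_ : NonZero S}} (F P : ℕ → ℕ) (F≤P : ∀ i j → F i ≤ P j) (F+P≡S : ∀ j → F j + P j ≡ S)
    (P-antitone : ∀ {i j} → i ≤ j → P j ≤ P i) (c : ℕ)
    (hit-scores : ∀ {T} → T < K → c ≤ BlockShares.hitScore K S F P (λ j → F≤P j j) F+P≡S T)
    (climb-conds : ∀ {T} → T < K → K * P T ≤ (K + (K ∸ suc T)) * F T)
    (no-hit-scores : ∀ {Θ} → Θ < K → c ≤ BlockShares.noHitScore K S F P (λ j → F≤P j j) F+P≡S Θ)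
    (last-score : c ≤ ∑ K (BlockShares.lowerScore K S F P (λ j → F≤P j j) F+P≡S))
    (b r : ℕ) {{_ : NonZero b}}
    (margin : 2 * (r * S) * ((K * b + 1) * (K * b + 1)) + 2 * (K * b * (2 * S)) * b ≤ b * (b * b * c)) where

  ratio : ∀ n (G : SimpleGraph n) → IsBipartite G → (pref : Fin n → List (Fin n)) → (∀ u → IsPrefOrder u (pref u)) →
    ∀ M → IsMatching G M → r * RDO.numOrders G pref * length M ≤ b * RDO.totalSize G pref
  ratio n G (colour , proper) pref order M matching = *-cancelˡ-≤ S (≤-trans
    (≤-trans (≤-reflexive (shuffle r S (RDO.numOrders G pref) (length M))) (matching-bound M matching))
    (≤-reflexive (shuffle′ b S (RDO.totalSize G pref))))
    where
    B = b * suc n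
    instance
      B≢0 : NonZero B
      B≢0 = m*n≢0 b (suc n)
    open EdgeBound K S F P F≤P F+P≡S P-antitone c hit-scores climb-conds no-hit-scores last-score B G colour proper pref order
    open Average (pred (K * B)) (suc-pred (K * B) {{m*n≢0 K B}}) (r * S) b
      (budget K S c b r (suc n) n (n≤1+n n) (m≤m*n (suc n) (suc n)) margin)
    shuffle : ∀ r s k m → s * (r * k * m) ≡ r * s * k * m
    shuffle = solve-∀
    shuffle′ : ∀ a s t → a * (s * t) ≡ s * (a * t)
    shuffle′ = solve-∀

-- Shares of the active endpoint on 80 blocks of ranks, in units of 10⁻⁴, found numerically:
-- each entry is the largest value, up to a plateau, that keeps every score above 2 · 80² · 6391.
shareTable : List ℕ
shareTable =
  3609 ∷ 3618 ∷ 3629 ∷ 3640 ∷ 3651 ∷ 3662 ∷ 3674 ∷ 3686 ∷ 3699 ∷ 3711 ∷ 3724 ∷ 3737 ∷ 3751 ∷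
  3765 ∷ 3779 ∷ 3795 ∷ 3810 ∷ 3826 ∷ 3842 ∷ 3860 ∷ 3877 ∷ 3897 ∷ 3915 ∷ 3936 ∷ 3956 ∷ 3977 ∷
  4000 ∷ 4024 ∷ 4049 ∷ 4074 ∷ 4102 ∷ 4130 ∷ 4161 ∷ 4192 ∷ 4225 ∷ 4261 ∷ 4297 ∷ 4338 ∷ 4380 ∷
  4424 ∷ 4473 ∷ 4524 ∷ 4580 ∷ 4600 ∷ 4600 ∷ 4600 ∷ 4600 ∷ 4600 ∷ 4600 ∷ 4600 ∷ 4600 ∷ 4600 ∷
  4600 ∷ 4600 ∷ 4600 ∷ 4600 ∷ 4600 ∷ 4600 ∷ 4600 ∷ 4600 ∷ 4600 ∷ 4600 ∷ 4600 ∷ 4600 ∷ []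

lookupOr : ℕ → List ℕ → ℕ → ℕ
lookupOr d [] _ = d
lookupOr d (x ∷ xs) zero = x
lookupOr d (x ∷ xs) (suc i) = lookupOr d xs i

lookupOr-≤ : ∀ {d xs} → All (_≤ d) xs → ∀ i → lookupOr d xs i ≤ d
lookupOr-≤ [] i = ≤-refl
lookupOr-≤ (x≤d ∷ _) zero = x≤d
lookupOr-≤ (_ ∷ xs≤d) (suc i) = lookupOr-≤ xs≤d i

lookupOr-mono : ∀ {d xs} → All (_≤ d) xs → Linked _≤_ xs → ∀ {i j} → i ≤ j → lookupOr d xs i ≤ lookupOr d xs j
lookupOr-mono [] _ _ = ≤-refl
lookupOr-mono (_ ∷ xs≤d) mono {suc i} {suc j} (s≤s i≤j) = lookupOr-mono xs≤d (Linked.tail mono) i≤j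
lookupOr-mono _ _ {zero} {zero} _ = ≤-refl
lookupOr-mono (x≤d ∷ []) _ {zero} {suc j} _ = x≤d
lookupOr-mono (_ ∷ xs≤d) (x≤y ∷ mono) {zero} {suc j} _ = ≤-trans x≤y (lookupOr-mono xs≤d mono {zero} {j} z≤n)

-- Behind the table the share is one half, for which `climb-conds` holds at every block. The plateau
-- value 4600 satisfies that condition up to block 65 and violates it from block 66 on.
activeShare passiveShare : ℕ → ℕ
activeShare = lookupOr 5000 shareTable
passiveShare j = 10000 ∸ activeShare j

shareTable-≤ : All (_≤ 5000) shareTable
shareTable-≤ = toWitness {a? = All.all? (_≤? 5000) shareTable} _

activeShare≤half : ∀ j → activeShare j ≤ 5000
activeShare≤half = lookupOr-≤ shareTable-≤

activeShare≤passiveShare : ∀ i j → activeShare i ≤ passiveShare j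
activeShare≤passiveShare i j = ≤-trans (activeShare≤half i) (∸-monoʳ-≤ 10000 (activeShare≤half j))

shares-sum : ∀ j → activeShare j + passiveShare j ≡ 10000
shares-sum j = m+[n∸m]≡n (≤-trans (activeShare≤half j) (m≤m+n 5000 5000))

passiveShare-antitone : ∀ {i j} → i ≤ j → passiveShare j ≤ passiveShare i
passiveShare-antitone i≤j = ∸-monoʳ-≤ 10000
  (lookupOr-mono shareTable-≤ (toWitness {a? = Linked.linked? _≤?_ shareTable} _) i≤j)

module Scores = BlockShares 80 10000 activeShare passiveShare (λ j → activeShare≤passiveShare j j) shares-sum

-- This is 2 · 80² · 6391: an average of 0.6391 · 10000 over the (80 B)² pairs of ranks, in units of
-- B² / 2. The excess over 0.639 is what `margin` spends on the error terms.
target : ℕ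
target = 81804800

hit-scores : ∀ {T} → T < 80 → target ≤ Scores.hitScore T
hit-scores = toWitness {a? = allUpTo? (λ T → target ≤? Scores.hitScore T) 80} _

climb-conds : ∀ {T} → T < 80 → 80 * passiveShare T ≤ (80 + (80 ∸ suc T)) * activeShare T
climb-conds = toWitness {a? = allUpTo? (λ T → 80 * passiveShare T ≤? (80 + (80 ∸ suc T)) * activeShare T) 80} _

no-hit-scores : ∀ {Θ} → Θ < 80 → target ≤ Scores.noHitScore Θ
no-hit-scores = toWitness {a? = allUpTo? (λ Θ → target ≤? Scores.noHitScore Θ) 80} _

last-score : target ≤ ∑ 80 Scores.lowerScore
last-score = toWitness {a? = target ≤? ∑ 80 Scores.lowerScore} _

margin : 2 * (639 * 10000) * ((80 * 1000 + 1) * (80 * 1000 + 1)) + 2 * (80 * 1000 * (2 * 10000)) * 1000 ≤ 1000 * (1000 * 1000 * target)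
margin = ≤ᵇ⇒≤ _ _ _

theorem1 : ∀ (n : ℕ) (G : SimpleGraph n) → IsBipartite G →
    (pref : Fin n → List (Fin n)) → (∀ u → IsPrefOrder u (pref u)) →
    (Mstar : List (Fin n × Fin n)) → IsMaximumMatching G Mstar →
    639 * RDO.numOrders G pref * Data.List.length Mstar ≤ 1000 * RDO.totalSize G pref
theorem1 n G bipartite pref order Mstar (matching , _) =
  Ratio.ratio 80 10000 activeShare passiveShare activeShare≤passiveShare shares-sum passiveShare-antitone
    target hit-scores climb-conds no-hit-scores last-score 1000 639 margin n G bipartite pref order Mstar matching
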